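{- For every integer $k\ge 2$, $$F_{21\text{ - }3\text{ - }\cdots\text{ - }k}(x,y)=1-\cfrac{x}{xy^{d_1}-\cfrac{1}{1-\cfrac{x}{xy^{d_2}-\cfrac{1}{1-\cfrac{x}{xy^{d_3}-\cfrac{1}{\ddots}}}}}},$$ where $d_i=\binom{i-1}{k-2}$ for $i\ge 1$, and $\binom ab$ is taken to be $0$ whenever $a<b$ or $b<0$.
   Context: Generalized patterns: a generalized pattern is a permutation $\tau=\tau_1\cdots\tau_k$ of $\{1,\dots,k\}$ written with dashes between some of its adjacent letters. An occurrence of $\tau$ in $\pi=\pi_1\cdots\pi_n\in S_n$ is a choice of positions $i_1<\dots<i_k$ such that $(\pi_{i_1},\dots,\pi_{i_k})$ is order-isomorphic to $(\tau_1,\dots,\tau_k)$ and $i_{j+1}=i_j+1$ whenever there is no dash between $\tau_j$ and $\tau_{j+1}$. The pattern $21\text{ - }3\text{ - }\cdots\text{ - }k$ requires only the first two letters to be adjacent in $\pi$ (for $k=2$ it is $21$). A permutation is $1\text{ - }3\text{ - }2$-avoiding if it has no occurrence of the classical (fully dashed) pattern $1\text{ - }3\text{ - }2$. $f_{\tau;r}(n)$ is the number of $1\text{ - }3\text{ - }2$-avoiding permutations in $S_n$ containing exactly $r$ occurrences of $\tau$ (with $S_0$ consisting of the empty permutation), and $F_\tau(x,y)=\sum_{n,r\ge 0} f_{\tau;r}(n)x^ny^r$, viewed as a formal power series in $x$ with coefficients in $\mathbb Z[y]$. The infinite continued fraction is a formal power series in $x$: writing $B_i=1-\dfrac{x}{xy^{d_i}-1/B_{i+1}}$,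 it is the $x$-adic limit as $m\to\infty$ of the finite fractions $B_1$ obtained by setting $B_m=1$. -}

module Defs where

open import Algebra.Bundles using (RawRing)
open import Data.Bool.Base using (Bool; true; false)
import Data.Bool.Properties as Bool
open import Data.Fin.Base using (Fin; zero; suc; toℕ; _<_)
import Data.Fin.Permutation as Perm
open Perm using (Permutation′; _⟨$⟩ʳ_)
import Data.Fin.Properties as Fin
open import Data.Integer.Base as ℤ using (ℤ; 0ℤ)
import Data.Integer.Properties as ℤ
open import Data.List.Base using (List; []; _∷_; allFin; cartesianProductWith; filter; length)
import Data.List.Properties as List
import Data.List.Relation.Unary.All as All
open import Data.Nat.Base as ℕ using (ℕ; zero; suc; _≤_; z≤n; s≤s; _∸_)
import Data.Nat.Properties as ℕ
open import Data.Product.Base using (Σ; ∃-syntax; _×_; _,_; proj₁; uncurry; <_,_>)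
open import Data.Sum.Base using (inj₁; inj₂)
open import Data.Vec.Base as Vec using (Vec; []; _∷_; lookup)
open import Data.Vec.Functional using (Vector)
open import Data.Vec.Relation.Unary.AllPairs using (allPairs?)
open import Data.Vec.Relation.Unary.Unique.Propositional using (Unique)
open import Function.Base using (_∘_; const)
open import Function.Bundles using (_⇔_; mk⇔; module Equivalence)
open import Level using (Level; 0ℓ)
open import Relation.Binary.PropositionalEquality
  using (_≡_; refl; trans; cong; cong₂)
open import Relation.Nullary.Decidable using (Dec; map′; ¬?; _×-dec_; _→-dec_)
open import Relation.Unary using (Decidable)

------------------------------------------------------------------------
-- Permutations and generalized patterns

words : ∀ m n → List (Vec (Fin n) m)
words zero    n = [] ∷ []
words (suc m) n = cartesianProductWith _∷_ (allFin n) (words m n)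

-- The elements of Sₙ in one-line notation, with letters 0 , … , n - 1
-- instead of 1 , … , n.
permutations : ∀ n → List (Vec (Fin n) n)
permutations n = filter unique? (words n n)
  where
  unique? : Decidable (Unique {n = n})
  unique? = allPairs? (λ a b → ¬? (a Fin.≟ b))

-- `dash j` tells whether there is a dash after the letter at position j;
-- its value at the last position is never used.
record Pattern (k : ℕ) : Set where
  field
    letters : Permutation′ k
    dash    : Fin k → Bool

open Pattern public

⟨1-3-2⟩ : Pattern 3
⟨1-3-2⟩ = record
  { letters = Perm.transpose (suc zero) (suc (suc zero))
  ; dash    = const true
  }

⟨21-3-⋯-k⟩ : ∀ {k} → 2 ≤ k → Pattern k
⟨21-3-⋯-k⟩ (s≤s (s≤s z≤n)) = record
  { letters = Perm.transpose zero (suc zero)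
  ; dash    = λ { zero → false ; (suc _) → true }
  }

module _ {k n : ℕ} (τ : Pattern k) (π : Vec (Fin n) n) where

  Increasing : Vec (Fin n) k → Set
  Increasing is = ∀ a b → a < b → lookup is a < lookup is b

  OrderIsomorphic : Vec (Fin n) k → Set
  OrderIsomorphic is = ∀ a b →
    (letters τ ⟨$⟩ʳ a < letters τ ⟨$⟩ʳ b) ⇔
    (lookup π (lookup is a) < lookup π (lookup is b))

  RespectsAdjacency : Vec (Fin n) k → Set
  RespectsAdjacency is = ∀ a b → toℕ b ≡ suc (toℕ a) → dash τ a ≡ false →
    toℕ (lookup is b) ≡ suc (toℕ (lookup is a))

  Occurrence : Vec (Fin n) k → Set
  Occurrence is = Increasing is × OrderIsomorphic is × RespectsAdjacency is

  occurrence? : Decidable Occurrence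
  occurrence? is =
    Fin.all? (λ a → Fin.all? λ b →
      (a Fin.<? b) →-dec (lookup is a Fin.<? lookup is b))
    ×-dec
    Fin.all? (λ a → Fin.all? λ b →
      ((letters τ ⟨$⟩ʳ a) Fin.<? (letters τ ⟨$⟩ʳ b)) ⇔-dec
      (lookup π (lookup is a) Fin.<? lookup π (lookup is b)))
    ×-dec
    Fin.all? (λ a → Fin.all? λ b →
      (toℕ b ℕ.≟ suc (toℕ a)) →-dec ((dash τ a Bool.≟ false) →-dec
      (toℕ (lookup is b) ℕ.≟ suc (toℕ (lookup is a)))))
    where
    _⇔-dec_ : {P Q : Set} → Dec P → Dec Q → Dec (P ⇔ Q)
    p? ⇔-dec q? = map′ (uncurry mk⇔) < Equivalence.to , Equivalence.from >
                       ((p? →-dec q?) ×-dec (q? →-dec p?))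

  occurrences : ℕ
  occurrences = length (filter occurrence? (words k n))

avoiders : ∀ n → List (Vec (Fin n) n)
avoiders n = filter (λ π → occurrences ⟨1-3-2⟩ π ℕ.≟ 0) (permutations n)

f : ∀ {k} → Pattern k → (r n : ℕ) → ℕ
f τ r n = length (filter (λ π → occurrences τ π ℕ.≟ r) (avoiders n))

------------------------------------------------------------------------
-- Formal power series

module PowerSeries {c ℓ : Level} (R : RawRing c ℓ) where

  open RawRing R
  open import Algebra.Definitions.RawSemiring rawSemiring using (sum)

  Series : Set c
  Series = ℕ → Carrier

  constant : Carrier → Series
  constant a zero    = a
  constant a (suc _) = 0#

  var : Series
  var 1 = 1#
  var _ = 0#

  cauchy : Series → Series → Series
  cauchy s t n = sum {suc n} λ i → s (toℕ i) * t (n ∸ toℕ i)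

  seriesRing : RawRing c ℓ
  seriesRing = record
    { Carrier = Series
    ; _≈_     = λ s t → ∀ n → s n ≈ t n
    ; _+_     = λ s t n → s n + t n
    ; _*_     = cauchy
    ; -_      = λ s n → - s n
    ; 0#      = const 0#
    ; 1#      = constant 1#
    }

  data UnitConstantTerm (s : Series) : Set ℓ where
    +1# : s 0 ≈ 1#   → UnitConstantTerm s
    -1# : s 0 ≈ - 1# → UnitConstantTerm s

  -- The inverse q of s, obtained by solving s * q ≈ 1 for the
  -- coefficients of q one after the other: q₀ = s₀⁻¹ and
  -- qₙ₊₁ = - s₀⁻¹ * ∑_{j ≤ n} sⱼ₊₁ * qₙ₋ⱼ.  Here s₀⁻¹ = s₀ = ± 1.
  recip : (s : Series) → UnitConstantTerm s → Series
  recip s u n = Vec.head (upTo n)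
    where
    s₀⁻¹ : UnitConstantTerm s → Carrier
    s₀⁻¹ (+1# _) = 1#
    s₀⁻¹ (-1# _) = - 1#

    -- upTo n = qₙ ∷ qₙ₋₁ ∷ … ∷ q₀ ∷ []
    upTo : ∀ n → Vec Carrier (suc n)
    upTo zero    = s₀⁻¹ u ∷ []
    upTo (suc n) =
      - (s₀⁻¹ u * sum (λ j → s (suc (toℕ j)) * lookup (upTo n) j)) ∷ upTo n

  -- Convergence in the x-adic topology.
  _ConvergesTo_ : (ℕ → Series) → Series → Set ℓ
  s ConvergesTo t =
    ∀ N → ∃[ M ] (∀ m → M ≤ m → ∀ n → n ℕ.< N → s m n ≈ t n)

------------------------------------------------------------------------
-- The polynomial ring ℤ[y]: finitely supported power series in y over ℤ

module ℤ⟦y⟧ = PowerSeries ℤ.+-*-rawRing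

open import Algebra.Definitions.RawSemiring ℤ.+-*-rawSemiring using (sum)

record Polynomial : Set where
  field
    coeff    : ℤ⟦y⟧.Series
    bound    : ℕ
    vanishes : ∀ r → bound ≤ r → coeff r ≡ 0ℤ

open Polynomial public

sum-zero : ∀ {n} (t : Vector ℤ n) → (∀ i → t i ≡ 0ℤ) → sum t ≡ 0ℤ
sum-zero {zero}  t t≡0 = refl
sum-zero {suc n} t t≡0 = cong₂ ℤ._+_ (t≡0 zero) (sum-zero (t ∘ suc) (t≡0 ∘ suc))

ℤ[y] : RawRing 0ℓ 0ℓ
ℤ[y] = record
  { Carrier = Polynomial
  ; _≈_     = λ p q → coeff p ≈ coeff q
  ; _+_     = λ p q → record
    { coeff    = coeff p + coeff q
    ; bound    = bound p ℕ.⊔ bound q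
    ; vanishes = λ r b≤r → cong₂ ℤ._+_
        (vanishes p r (ℕ.≤-trans (ℕ.m≤m⊔n (bound p) (bound q)) b≤r))
        (vanishes q r (ℕ.≤-trans (ℕ.m≤n⊔m (bound p) (bound q)) b≤r))
    }
  ; _*_     = λ p q → record
    { coeff    = coeff p * coeff q
    ; bound    = bound p ℕ.+ bound q
    ; vanishes = λ r b≤r → sum-zero {suc r} _ λ i → product-vanishes p q r (toℕ i) b≤r
    }
  ; -_      = λ p → record
    { coeff    = - coeff p
    ; bound    = bound p
    ; vanishes = λ r b≤r → cong ℤ.-_ (vanishes p r b≤r)
    }
  ; 0#      = record { coeff = 0# ; bound = 0 ; vanishes = λ _ _ → refl }
  ; 1#      = record { coeff = 1# ; bound = 1 ; vanishes = λ { (suc _) _ → refl } }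
  }
  where
  open RawRing ℤ⟦y⟧.seriesRing

  product-vanishes : ∀ p q r i → bound p ℕ.+ bound q ≤ r →
                     coeff p i ℤ.* coeff q (r ∸ i) ≡ 0ℤ
  product-vanishes p q r i b≤r with ℕ.≤-total (bound p) i
  ... | inj₁ bp≤i = cong (ℤ._* coeff q (r ∸ i)) (vanishes p i bp≤i)
  ... | inj₂ i≤bp = trans
    (cong (coeff p i ℤ.*_) (vanishes q (r ∸ i)
      (ℕ.m+n≤o⇒m≤o∸n (bound q) (ℕ.≤-trans (ℕ.+-monoʳ-≤ (bound q) i≤bp)
        (ℕ.≤-trans (ℕ.≤-reflexive (ℕ.+-comm (bound q) (bound p))) b≤r)))))
    (ℤ.*-zeroʳ (coeff p i))

y : Polynomial
y = record
  { coeff    = ℤ⟦y⟧.var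
  ; bound    = 2
  ; vanishes = λ { 1 (s≤s ()) ; (suc (suc _)) _ → refl }
  }

------------------------------------------------------------------------
-- The generating function, as an element of ℤ[y]⟦x⟧

open PowerSeries ℤ[y] public

-- An r exceeding the number of candidate position tuples is not attained.
F : ∀ {k} → Pattern k → Series
F {k} τ n = record
  { coeff    = λ r → ℤ.+ f τ r n
  ; bound    = suc (length (words k n))
  ; vanishes = λ r b≤r → cong (ℤ.+_ ∘ length)
      (List.filter-none (λ π → occurrences τ π ℕ.≟ r) {avoiders n}
        (All.universal (λ π → ℕ.<⇒≢ (ℕ.≤-<-trans
          (List.length-filter (occurrence? τ π) (words k n)) b≤r)) (avoiders n)))
  }

------------------------------------------------------------------------
-- The continued fraction

x : Series
x = var

private
  module P  = RawRing ℤ[y]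
  module PS = RawRing seriesRing

open import Algebra.Definitions.RawSemiring P.rawSemiring using (_^_)
open PS using (1#; _+_; _*_; -_)

infixl 6 _-_
_-_ : Series → Series → Series
s - t = s + (- t)

x*-constantTerm : ∀ s r → coeff ((x * s) 0) r ≡ 0ℤ
x*-constantTerm s r = cong (ℤ._+ 0ℤ)
  (sum-zero (λ (i : Fin (suc r)) → 0ℤ ℤ.* coeff (s 0) (r ∸ toℕ i)) (λ _ → refl))

Normalized : Set
Normalized = Σ Series λ s → s 0 P.≈ P.1#

-- B ↦ 1 - x / (x y^d - 1 / B)
step : ℕ → Normalized → Normalized
step d (B , B₀≈1) = 1# - x * recip D (-1# D₀≈-1) , B′₀≈1
  where
  D : Series
  D = x * constant (y ^ d) - recip B (+1# B₀≈1)

  D₀≈-1 : D 0 P.≈ P.- P.1#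
  D₀≈-1 r = trans
    (cong (ℤ._+ coeff (P.- P.1#) r) (x*-constantTerm (constant (y ^ d)) r))
    (ℤ.+-identityˡ _)

  B′₀≈1 : (1# - x * recip D (-1# D₀≈-1)) 0 P.≈ P.1#
  B′₀≈1 r = trans
    (cong (λ z → coeff P.1# r ℤ.+ ℤ.- z) (x*-constantTerm (recip D (-1# D₀≈-1)) r))
    (ℤ.+-identityʳ _)

-- `tail d i l` is Bᵢ when Bᵢ₊ₗ is set to 1.
tail : (ℕ → ℕ) → ℕ → ℕ → Normalized
tail d i zero    = 1# , λ _ → refl
tail d i (suc l) = step (d i) (tail d (suc i) l)

-- `convergent d l` is B₁ when B₁₊ₗ is set to 1; only the values d i with
-- i ≥ 1 are used.
convergent : (ℕ → ℕ) → ℕ → Series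
convergent d l = proj₁ (tail d 1 l)

module Submission where

open import Defs
open import Data.Nat.Base using (ℕ; _≤_; _∸_)
open import Data.Nat.Combinatorics using (_C_)

-- A non-empty 1-3-2-avoiding permutation is L n R with L and R avoiding 1-3-2 and every letter
-- of L above every letter of R.  An occurrence of 21-3-⋯-j in L n R lies in L, lies in R, or
-- consists of an occurrence of 21-3-⋯-(j-1) in L followed by n; for j = 2 there is one more,
-- which starts with n, as soon as R is non-empty.  Put K = k - 2 and let the weight of π be y to
-- the power sₑ(π) = ∑ⱼ (e choose K-j) · #(21-3-⋯-(j+2) in π).  By Pascal's rule
--   sₑ(L n R) = sₑ₊₁(L) + sₑ(R) + (e choose K) · [R ≠ ∅],
-- so the generating functions satisfy Gₑ = 1 + x Gₑ₊₁ (1 + y^(e choose K) (Gₑ - 1)).  Without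
-- denominators this is Gₑ = 1 - x / (x y^(e choose K) - 1 / Gₑ₊₁), and solving it for Gₑ
-- gains one correct coefficient over Gₑ₊₁.

open import Algebra.Bundles using (RawRing; CommutativeRing)
open import Algebra.Morphism.Structures using (IsRingMonomorphism)
import Algebra.Morphism.RingMonomorphism as RingMonomorphism
import Algebra.Properties.CommutativeSemigroup
import Algebra.Properties.Monoid.Sum
import Algebra.Properties.Ring
import Algebra.Properties.Semiring.Exp
open import Algebra.Structures using (IsCommutativeRing)
open import Data.Bool.Base using (true; false; if_then_else_; _∧_)
open import Data.Empty using (⊥-elim)
open import Data.Fin.Base as Fin using (Fin; zero; suc; toℕ; fromℕ<)
open import Data.Fin.Permutation using (_⟨$⟩ʳ_; _⟨$⟩ˡ_; inverseˡ)
import Data.Fin.Properties as Fin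
import Data.Integer.Base as ℤ
import Data.Integer.Properties as ℤ
open import Data.List.Base as List
  using (List; []; _∷_; _++_; cartesianProductWith; concat; drop; filter; foldr; length; map; tabulate; upTo)
open import Data.List.Membership.Propositional using (_∈_)
open import Data.List.Membership.Propositional.Properties
  using (∈-∃++; ∈-++⁻; ∈-++⁺ˡ; ∈-++⁺ʳ; ∈-upTo⁺; ∈-upTo⁻; ∈-allFin; ∈-length; ∈-filter⁺; ∈-filter⁻; ∈-map⁺; ∈-map⁻;
         ∈-cartesianProductWith⁺; ∈-cartesianProductWith⁻; ∈-concat⁺′; ∈-concat⁻′; ∈-tabulate⁺; ∈-tabulate⁻)
open import Data.List.Membership.Propositional.Properties.WithK using (unique∧set⇒bag)
import Data.List.Properties as List
open import Data.List.Relation.Binary.BagAndSetEquality using (∼bag⇒↭)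
open import Data.List.Relation.Binary.Disjoint.Propositional using (Disjoint)
open import Data.List.Relation.Binary.Permutation.Propositional as ↭ using (_↭_)
open import Data.List.Relation.Binary.Subset.Propositional using (_⊆_)
open import Data.List.Relation.Unary.All as All using (All; []; _∷_)
import Data.List.Relation.Unary.All.Properties as All
open import Data.List.Relation.Unary.AllPairs as AllPairs using (AllPairs; []; _∷_)
import Data.List.Relation.Unary.AllPairs.Properties as AllPairs
open import Data.List.Relation.Unary.Any using (here; there)
open import Data.List.Relation.Unary.Unique.Propositional using (Unique)
import Data.List.Relation.Unary.Unique.Propositional.Properties as Unique
open import Data.Nat.Base as ℕ using (zero; suc; z≤n; s≤s; _<_; _<ᵇ_; _≡ᵇ_)
open import Data.Nat.Combinatorics using (nCk+nC[k+1]≡[n+1]C[k+1])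
import Data.Nat.Properties as ℕ
open import Data.Nat.Tactic.RingSolver using (solve-∀)
open import Data.Product.Base using (_×_; _,_; proj₁; proj₂; ∃; ∃₂)
open import Data.Sum.Base using (inj₁; inj₂)
open import Data.Unit.Base using (⊤; tt)
open import Data.Vec.Base as Vec using (Vec; []; _∷_; lookup)
import Data.Vec.Properties as Vec
import Data.Vec.Relation.Unary.All as VecAll
import Data.Vec.Relation.Unary.AllPairs as VecAllPairs
open import Data.Vec.Relation.Unary.Unique.Propositional using () renaming (Unique to VecUnique)
import Data.Vec.Relation.Unary.Unique.Propositional.Properties as VecUnique
open import Function.Base using (_∘_; id)
open import Function.Bundles using (mk⇔; module Equivalence)
open import Level using (Level)
open import Relation.Binary.Core using (Rel)
open import Relation.Binary.Definitions using (tri<; tri≈; tri>)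
open import Relation.Binary.PropositionalEquality as ≡ using (_≡_; _≢_)
import Relation.Binary.Reasoning.Setoid
open import Relation.Nullary.Decidable using (Dec; does; yes; no; _×-dec_; dec-true; dec-false)
open import Relation.Nullary.Negation using (¬_)
open import Relation.Unary using (Decidable; _≐_)

-- Power series over a commutative ring

-- Nothing else can cross `L n R`: the step from the last letter of `L` to `n` is no descent,
-- nothing exceeds `n`, and the letters of `R` are too small to continue a descent begun in `L`.
-- That `L` lies above `R` is avoidance itself, since `a < c` with `a` in `L` and `c` in `R` would
-- make `a n c` a 1-3-2. The obstacle is that a recursion for one pattern calls for all shorter
-- ones, with multiplicities that change at each passage into a left part. The family of weights is
-- closed under this: such a passage only raises `e` by one. At `e = 0` the single term `j = K`
-- survives, so `G₀` is the series sought, and level `e` stands at place `i = e + 1` of the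
-- fraction, whence the `i - 1` in the exponents. The enumerators and the truncated fractions are
-- compared only through the division-free equation, which both satisfy.

module _ {c ℓ : Level} (R : CommutativeRing c ℓ) where

  open CommutativeRing R hiding (_-_)
  open Relation.Binary.Reasoning.Setoid setoid
  open Algebra.Properties.Ring ring using (-‿distribʳ-*; -‿+-comm; xyx⁻¹≈y; \\-leftDividesˡ)

  -- `Q` and `E` are the inverses of `B` and `D`. Multiplying `D ≈ X * Y + - Q` by `E` gives
  -- `Y * (X * E) ≈ 1# + Q * E`, so the factor next to `B` is `- (Q * E)`, and there `B` cancels
  -- `Q`.
  clear-denominators : ∀ {X Y B Q D E} → B * Q ≈ 1# → D ≈ X * Y + - Q → D * E ≈ 1# →
                       1# + - (X * E) ≈ 1# + X * (B * (1# + Y * ((1# + - (X * E)) + - 1#)))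
  clear-denominators {X} {Y} {B} {Q} {D} {E} BQ≈1 D≈ DE≈1 = +-congˡ (begin
    - (X * E)                                        ≈⟨ -‿distribʳ-* X E ⟩
    X * - E                                          ≈⟨ *-congˡ B*-QE≈-E ⟨
    X * (B * - (Q * E))                              ≈⟨ *-congˡ (*-congˡ 1-Y*XE≈-QE) ⟨
    X * (B * (1# + Y * ((1# + - (X * E)) + - 1#)))   ∎)
    where
    Y*XE≈1+QE : Y * (X * E) ≈ 1# + Q * E
    Y*XE≈1+QE = begin
      Y * (X * E)              ≈⟨ *-assoc _ _ _ ⟨
      Y * X * E                ≈⟨ *-congʳ (*-comm Y X) ⟩
      X * Y * E                ≈⟨ *-congʳ (trans (+-congˡ (-‿inverseˡ Q)) (+-identityʳ _)) ⟨
      (X * Y + (- Q + Q)) * E  ≈⟨ *-congʳ (trans (+-congʳ D≈) (+-assoc _ _ _)) ⟨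
      (D + Q) * E              ≈⟨ distribʳ _ _ _ ⟩
      D * E + Q * E            ≈⟨ +-congʳ DE≈1 ⟩
      1# + Q * E               ∎

    1-Y*XE≈-QE : 1# + Y * ((1# + - (X * E)) + - 1#) ≈ - (Q * E)
    1-Y*XE≈-QE = begin
      1# + Y * ((1# + - (X * E)) + - 1#)  ≈⟨ +-congˡ (*-congˡ (xyx⁻¹≈y 1# _)) ⟩
      1# + Y * - (X * E)                  ≈⟨ +-congˡ (-‿distribʳ-* Y _) ⟨
      1# + - (Y * (X * E))                ≈⟨ +-congˡ (-‿cong Y*XE≈1+QE) ⟩
      1# + - (1# + Q * E)                 ≈⟨ +-congˡ (-‿+-comm _ _) ⟨
      1# + (- 1# + - (Q * E))             ≈⟨ \\-leftDividesˡ 1# _ ⟩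
      - (Q * E)                           ∎

    B*-QE≈-E : B * - (Q * E) ≈ - E
    B*-QE≈-E = begin
      B * - (Q * E)   ≈⟨ -‿distribʳ-* B _ ⟨
      - (B * (Q * E)) ≈⟨ -‿cong (*-assoc _ _ _) ⟨
      - (B * Q * E)   ≈⟨ -‿cong (trans (*-congʳ BQ≈1) (*-identityˡ E)) ⟩
      - E             ∎

-- The ring of formal power series, reciprocals, and the step of the fraction

module SeriesRing {c ℓ : Level} (R : RawRing c ℓ)
  (isCommutativeRing : IsCommutativeRing (RawRing._≈_ R) (RawRing._+_ R) (RawRing._*_ R)
                         (RawRing.-_ R) (RawRing.0# R) (RawRing.1# R)) where

  commutativeRing : CommutativeRing c ℓ
  commutativeRing = record { isCommutativeRing = isCommutativeRing }

  open CommutativeRing commutativeRing hiding (isCommutativeRing; zero)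
  open Algebra.Properties.Monoid.Sum +-monoid using (sum; sum-cong-≗)
  private module S = PowerSeries R
  open RawRing S.seriesRing using () renaming (_≈_ to _≈ₛ_; _+_ to _+ₛ_; _*_ to _*ₛ_; -_ to -ₛ_; 0# to 0ₛ; 1# to 1ₛ)
  open Algebra.Properties.Ring ring using (-‿distribʳ-*; -1*x≈-x; -‿involutive)
  open Algebra.Properties.CommutativeSemigroup +-commutativeSemigroup using (interchange; x∙yz≈y∙xz)
  open Relation.Binary.Reasoning.Setoid setoid

  -- The hypotheses stop at `n` because the contraction argument knows agreement of coefficients
  -- only up to a bound.
  cauchy-cong : ∀ {s s′ t t′} n → (∀ i → i ≤ n → s i ≈ s′ i) → (∀ i → i ≤ n → t i ≈ t′ i) →
                (s *ₛ t) n ≈ (s′ *ₛ t′) n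
  cauchy-cong zero    s≈ t≈ = +-congʳ (*-cong (s≈ 0 z≤n) (t≈ 0 z≤n))
  cauchy-cong {s} {s′} (suc n) s≈ t≈ =
    +-cong (*-cong (s≈ 0 z≤n) (t≈ (suc n) ℕ.≤-refl))
           (cauchy-cong {s ∘ suc} {s′ ∘ suc} n (λ i i≤n → s≈ (suc i) (s≤s i≤n)) (λ i i≤n → t≈ i (ℕ.m≤n⇒m≤1+n i≤n)))

  *ₛ-distribʳ-+ₛ : ∀ u s t → ((s +ₛ t) *ₛ u) ≈ₛ ((s *ₛ u) +ₛ (t *ₛ u))
  *ₛ-distribʳ-+ₛ u s t zero = begin
    (s 0 + t 0) * u 0 + 0#             ≈⟨ +-identityʳ _ ⟩
    (s 0 + t 0) * u 0                  ≈⟨ distribʳ _ _ _ ⟩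
    s 0 * u 0 + t 0 * u 0              ≈⟨ +-cong (+-identityʳ _) (+-identityʳ _) ⟨
    s 0 * u 0 + 0# + (t 0 * u 0 + 0#)  ∎
  *ₛ-distribʳ-+ₛ u s t (suc n) = trans
    (+-cong (distribʳ _ _ _) (*ₛ-distribʳ-+ₛ u (s ∘ suc) (t ∘ suc) n))
    (interchange _ _ _ _)

  -- `cauchy` unfolds by peeling off the first coefficient of the left factor. Peeling off that of
  -- the right factor is the mirror image that lets the induction for `*ₛ-comm` close.
  *ₛ-shiftʳ : ∀ s t n → (s *ₛ t) (suc n) ≈ s (suc n) * t 0 + (s *ₛ (t ∘ suc)) n
  *ₛ-shiftʳ s t zero    = x∙yz≈y∙xz _ _ _
  *ₛ-shiftʳ s t (suc n) = trans (+-congˡ (*ₛ-shiftʳ (s ∘ suc) t n)) (x∙yz≈y∙xz _ _ _)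

  *ₛ-comm : ∀ s t → (s *ₛ t) ≈ₛ (t *ₛ s)
  *ₛ-comm s t zero    = +-congʳ (*-comm _ _)
  *ₛ-comm s t (suc n) = begin
    s 0 * t (suc n) + ((s ∘ suc) *ₛ t) n  ≈⟨ +-cong (*-comm _ _) (*ₛ-comm (s ∘ suc) t n) ⟩
    t (suc n) * s 0 + (t *ₛ (s ∘ suc)) n  ≈⟨ *ₛ-shiftʳ t s n ⟨
    (t *ₛ s) (suc n)                      ∎

  *ₛ-scale : ∀ a s t n → ((λ i → a * s i) *ₛ t) n ≈ a * (s *ₛ t) n
  *ₛ-scale a s t zero    = begin
    a * s 0 * t 0 + 0#    ≈⟨ +-identityʳ _ ⟩
    a * s 0 * t 0         ≈⟨ *-assoc _ _ _ ⟩
    a * (s 0 * t 0)       ≈⟨ *-congˡ (+-identityʳ _) ⟨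
    a * (s 0 * t 0 + 0#)  ∎
  *ₛ-scale a s t (suc n) = trans
    (+-cong (*-assoc _ _ _) (*ₛ-scale a (s ∘ suc) t n))
    (sym (distribˡ _ _ _))

  *ₛ-assoc : ∀ s t u → ((s *ₛ t) *ₛ u) ≈ₛ (s *ₛ (t *ₛ u))
  *ₛ-assoc s t u zero = begin
    (s 0 * t 0 + 0#) * u 0 + 0#  ≈⟨ +-congʳ (*-congʳ (+-identityʳ _)) ⟩
    s 0 * t 0 * u 0 + 0#         ≈⟨ +-congʳ (*-assoc _ _ _) ⟩
    s 0 * (t 0 * u 0) + 0#       ≈⟨ +-congʳ (*-congˡ (+-identityʳ _)) ⟨
    s 0 * (t 0 * u 0 + 0#) + 0#  ∎
  *ₛ-assoc s t u (suc n) = begin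
    -- The sum in the second summand is what `(s *ₛ t) ∘ suc` unfolds to.
    (s 0 * t 0 + 0#) * u (suc n) + (((λ i → s 0 * t (suc i)) +ₛ ((s ∘ suc) *ₛ t)) *ₛ u) n
      ≈⟨ +-cong (trans (*-congʳ (+-identityʳ _)) (*-assoc _ _ _)) 
                (*ₛ-distribʳ-+ₛ u (λ i → s 0 * t (suc i)) ((s ∘ suc) *ₛ t) n) ⟩
    s 0 * (t 0 * u (suc n)) + (((λ i → s 0 * t (suc i)) *ₛ u) n + (((s ∘ suc) *ₛ t) *ₛ u) n)
      ≈⟨ +-assoc _ _ _ ⟨
    s 0 * (t 0 * u (suc n)) + ((λ i → s 0 * t (suc i)) *ₛ u) n + (((s ∘ suc) *ₛ t) *ₛ u) n
      ≈⟨ +-cong (trans (+-congˡ (*ₛ-scale (s 0) (t ∘ suc) u n)) (sym (distribˡ _ _ _)))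
                (*ₛ-assoc (s ∘ suc) t u n) ⟩
    s 0 * (t *ₛ u) (suc n) + ((s ∘ suc) *ₛ (t *ₛ u)) n
      ∎

  *ₛ-zeroˡ : ∀ s → (0ₛ *ₛ s) ≈ₛ 0ₛ
  *ₛ-zeroˡ s zero    = trans (+-identityʳ _) (zeroˡ _)
  *ₛ-zeroˡ s (suc n) = trans (+-cong (zeroˡ _) (*ₛ-zeroˡ s n)) (+-identityʳ _)

  *ₛ-constantˡ : ∀ a s n → (S.constant a *ₛ s) n ≈ a * s n
  *ₛ-constantˡ a s zero    = +-identityʳ _
  *ₛ-constantˡ a s (suc n) = trans (+-congˡ (*ₛ-zeroˡ s n)) (+-identityʳ _)

  *ₛ-identityˡ : ∀ s → (1ₛ *ₛ s) ≈ₛ s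
  *ₛ-identityˡ s n = trans (*ₛ-constantˡ 1# s n) (*-identityˡ _)

  var*-suc : ∀ s n → (S.var *ₛ s) (suc n) ≈ s n
  var*-suc s n = begin
    0# * s (suc n) + ((S.var ∘ suc) *ₛ s) n
      ≈⟨ +-cong (zeroˡ _) (cauchy-cong {S.var ∘ suc} {1ₛ} {s} {s} n
           (λ { zero _ → refl ; (suc _) _ → refl }) (λ _ _ → refl)) ⟩
    0# + (1ₛ *ₛ s) n  ≈⟨ +-identityˡ _ ⟩
    (1ₛ *ₛ s) n       ≈⟨ *ₛ-identityˡ s n ⟩
    s n               ∎

  var*-zero : ∀ s → (S.var *ₛ s) 0 ≈ 0#
  var*-zero s = trans (+-identityʳ _) (zeroˡ _)

  isCommutativeRingₛ : IsCommutativeRing _≈ₛ_ _+ₛ_ _*ₛ_ -ₛ_ 0ₛ 1ₛ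
  isCommutativeRingₛ = record
    { isRing = record
      { +-isAbelianGroup = record
        { isGroup = record
          { isMonoid = record
            { isSemigroup = record
              { isMagma = record
                { isEquivalence = record
                  { refl  = λ _ → refl
                  ; sym   = λ s≈t n → sym (s≈t n)
                  ; trans = λ s≈t t≈u n → trans (s≈t n) (t≈u n)
                  }
                ; ∙-cong = λ s≈s′ t≈t′ n → +-cong (s≈s′ n) (t≈t′ n)
                }
              ; assoc = λ s t u n → +-assoc _ _ _
              }
            ; identity = (λ s n → +-identityˡ _) , (λ s n → +-identityʳ _)
            }
          ; inverse = (λ s n → -‿inverseˡ _) , (λ s n → -‿inverseʳ _)
          ; ⁻¹-cong = λ s≈t n → -‿cong (s≈t n)
          }
        ; comm = λ s t n → +-comm _ _
        }
      ; *-cong = λ {s} {s′} {t} {t′} s≈ t≈ n → cauchy-cong {s} {s′} {t} {t′} n (λ i _ → s≈ i) (λ i _ → t≈ i)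
      ; *-assoc = *ₛ-assoc
      ; *-identity = *ₛ-identityˡ , λ s n → trans (*ₛ-comm s 1ₛ n) (*ₛ-identityˡ s n)
      ; distrib =
          (λ s t u n → trans (*ₛ-comm s (t +ₛ u) n) (trans (*ₛ-distribʳ-+ₛ s t u n)
                          (+-cong (*ₛ-comm t s n) (*ₛ-comm u s n))))
        , *ₛ-distribʳ-+ₛ
      }
    ; *-comm = *ₛ-comm
    }

  -- The vectors in `recip` list the coefficients downwards; reading position `j` as coefficient
  -- `n ∸ toℕ j` turns their recurrence into a Cauchy product.
  lookup-head : (V : ∀ n → Vec Carrier (suc n)) (h : ∀ n → Carrier) →
                (∀ n → V (suc n) ≡ h n ∷ V n) → ∀ n j → lookup (V n) j ≡ Vec.head (V (n ∸ toℕ j))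
  lookup-head V h V-suc zero zero with V zero
  ... | _ ∷ [] = ≡.refl
  lookup-head V h V-suc (suc n) zero    rewrite V-suc n = ≡.refl
  lookup-head V h V-suc (suc n) (suc j) rewrite V-suc n = lookup-head V h V-suc n j

  module _ (s : S.Series) where

    -- The local functions upTo and s₀⁻¹ of recip have no name here, and they take the argument
    -- of recip as an additional parameter m.  They are found by unification: in the unfolded
    -- coefficient suc (suc n), the parameter m and the argument n of upTo are different terms,
    -- so that generalizing over suc (suc n) and lookup leaves a pattern problem.
    mutual

      recips : S.UnitConstantTerm s → ℕ → ∀ n → Vec Carrier (suc n)
      recips u m n = _

      leading : S.UnitConstantTerm s → ℕ → Carrier
      leading u m = _

      recip-2+ : ∀ u n →
        let next = λ {l} (v : Vec Carrier (suc l)) →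
                     - (leading u (suc (suc n)) * sum λ j → s (suc (toℕ j)) * lookup v j)
            v = recips u (suc (suc n)) n
        in S.recip s u (suc (suc n)) ≡ next (next v ∷ v)
      recip-2+ u n with ℕ.suc (ℕ.suc n) | lookup {A = Carrier} {n = suc n}
      ... | _ | _ = ≡.refl

    -- A named counterpart of the local function of `recip`. The two are separate definitions by
    -- cases that agree once the constructor is known, hence the splits on `u` in `recips-zero` and
    -- `recips-suc`.
    s₀⁻¹ : S.UnitConstantTerm s → Carrier
    s₀⁻¹ (S.+1# _) = 1#
    s₀⁻¹ (S.-1# _) = - 1#

    next : S.UnitConstantTerm s → ∀ {n} → Vec Carrier (suc n) → Carrier
    next u v = - (s₀⁻¹ u * sum λ j → s (suc (toℕ j)) * lookup v j)

    recips-zero : ∀ u m → recips u m 0 ≡ s₀⁻¹ u ∷ []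
    recips-zero (S.+1# _) m = ≡.refl
    recips-zero (S.-1# _) m = ≡.refl

    recips-suc : ∀ u m n → recips u m (suc n) ≡ next u (recips u m n) ∷ recips u m n
    recips-suc (S.+1# _) m n = ≡.refl
    recips-suc (S.-1# _) m n = ≡.refl

    -- Computing coefficient `suc n` builds all its vectors with parameter `suc n`, whereas
    -- coefficient `n ∸ j` of `recip` is built with parameter `n ∸ j`. Identifying them makes the
    -- recurrence in `recip-suc` refer to `recip` itself.
    recips-irrelevant : ∀ u m m′ n → recips u m n ≡ recips u m′ n
    recips-irrelevant u m m′ zero    = ≡.trans (recips-zero u m) (≡.sym (recips-zero u m′))
    recips-irrelevant u m m′ (suc n) = ≡.trans (recips-suc u m n)
      (≡.trans (≡.cong (λ v → next u v ∷ v) (recips-irrelevant u m m′ n))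
               (≡.sym (recips-suc u m′ n)))

    recip-zero : ∀ u → S.recip s u 0 ≡ s₀⁻¹ u
    recip-zero u = ≡.cong Vec.head (recips-zero u 0)

    recip-suc : ∀ u n → S.recip s u (suc n) ≡ - (s₀⁻¹ u * ((s ∘ suc) *ₛ S.recip s u) n)
    recip-suc u n = ≡.trans (≡.cong Vec.head (recips-suc u (suc n) n))
      (≡.cong (λ z → - (s₀⁻¹ u * z)) (sum-cong-≗ {suc n} λ j → ≡.cong (s (suc (toℕ j)) *_)
        (≡.trans (lookup-head (recips u (suc n)) _ (recips-suc u (suc n)) n j)
                 (≡.cong Vec.head (recips-irrelevant u (suc n) (n ∸ toℕ j) (n ∸ toℕ j))))))

    s₀≈s₀⁻¹ : ∀ u → s 0 ≈ s₀⁻¹ u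
    s₀≈s₀⁻¹ (S.+1# s₀≈1)  = s₀≈1
    s₀≈s₀⁻¹ (S.-1# s₀≈-1) = s₀≈-1

    s₀⁻¹*s₀⁻¹ : ∀ u → s₀⁻¹ u * s₀⁻¹ u ≈ 1#
    s₀⁻¹*s₀⁻¹ (S.+1# _) = *-identityˡ 1#
    s₀⁻¹*s₀⁻¹ (S.-1# _) = trans (-1*x≈-x (- 1#)) (-‿involutive 1#)

    *-recip : ∀ u → (s *ₛ S.recip s u) ≈ₛ 1ₛ
    *-recip u zero = begin
      s 0 * S.recip s u 0 + 0#  ≈⟨ +-identityʳ _ ⟩
      s 0 * S.recip s u 0       ≈⟨ *-cong (s₀≈s₀⁻¹ u) (reflexive (recip-zero u)) ⟩
      s₀⁻¹ u * s₀⁻¹ u           ≈⟨ s₀⁻¹*s₀⁻¹ u ⟩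
      1#                        ∎
    *-recip u (suc n) = begin
      s 0 * S.recip s u (suc n) + z      ≈⟨ +-congʳ (*-cong (s₀≈s₀⁻¹ u) (reflexive (recip-suc u n))) ⟩
      s₀⁻¹ u * - (s₀⁻¹ u * z) + z        ≈⟨ +-congʳ (-‿distribʳ-* _ _) ⟨
      - (s₀⁻¹ u * (s₀⁻¹ u * z)) + z      ≈⟨ +-congʳ (-‿cong (*-assoc _ _ _)) ⟨
      - (s₀⁻¹ u * s₀⁻¹ u * z) + z        ≈⟨ +-congʳ (-‿cong (trans (*-congʳ (s₀⁻¹*s₀⁻¹ u)) (*-identityˡ z))) ⟩
      - z + z                            ≈⟨ -‿inverseˡ z ⟩
      0#                                 ∎
      where z = ((s ∘ suc) *ₛ S.recip s u) n

  -- The enumerator of a right part, when `B 0 ≈ 1#`: the constant term, which stands for the empty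
  -- word, is kept, and every other coefficient gains the factor `a`.
  factor : Carrier → S.Series → S.Series
  factor a B = 1ₛ +ₛ S.constant a *ₛ (B +ₛ -ₛ 1ₛ)

  -- B = 1 - x / (x a - 1 / A) without denominators.  This is a record because Agda would
  -- otherwise compare two instances by unfolding their series, which explodes over ℤ[y].
  record IsStep (a : Carrier) (A B : S.Series) : Set ℓ where
    constructor isStep
    field equation : B ≈ₛ (1ₛ +ₛ S.var *ₛ (A *ₛ factor a B))

  IsStep-zero : ∀ {a A B} → IsStep a A B → B 0 ≈ 1#
  IsStep-zero {a} {A} {B} (isStep B≈) = begin
    B 0                                   ≈⟨ B≈ 0 ⟩
    1# + (S.var *ₛ (A *ₛ factor a B)) 0  ≈⟨ +-congˡ (var*-zero (A *ₛ factor a B)) ⟩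
    1# + 0#                               ≈⟨ +-identityʳ 1# ⟩
    1#                                    ∎

  IsStep-suc : ∀ {a A B} → IsStep a A B → ∀ n → B (suc n) ≈ (A *ₛ factor a B) n
  IsStep-suc {a} {A} {B} (isStep B≈) n = begin
    B (suc n)                                   ≈⟨ B≈ (suc n) ⟩
    0# + (S.var *ₛ (A *ₛ factor a B)) (suc n)  ≈⟨ +-identityˡ _ ⟩
    (S.var *ₛ (A *ₛ factor a B)) (suc n)       ≈⟨ var*-suc (A *ₛ factor a B) n ⟩
    (A *ₛ factor a B) n                        ∎

  IsStep-intro : ∀ {a A B} → B 0 ≈ 1# → (∀ n → B (suc n) ≈ (A *ₛ factor a B) n) → IsStep a A B
  IsStep-intro {a} {A} {B} B₀≈1 B-suc = isStep λ where
    zero → begin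
      B 0                                   ≈⟨ B₀≈1 ⟩
      1#                                    ≈⟨ +-identityʳ 1# ⟨
      1# + 0#                               ≈⟨ +-congˡ (var*-zero (A *ₛ factor a B)) ⟨
      1# + (S.var *ₛ (A *ₛ factor a B)) 0   ∎
    (suc n) → begin
      B (suc n)                                   ≈⟨ B-suc n ⟩
      (A *ₛ factor a B) n                         ≈⟨ var*-suc (A *ₛ factor a B) n ⟨
      (S.var *ₛ (A *ₛ factor a B)) (suc n)        ≈⟨ +-identityˡ _ ⟨
      0# + (S.var *ₛ (A *ₛ factor a B)) (suc n)   ∎

  factor-cong : ∀ a {B B′} n → B n ≈ B′ n → factor a B n ≈ factor a B′ n
  factor-cong a {B} {B′} n B≈B′ = +-congˡ (begin
    (S.constant a *ₛ (B +ₛ -ₛ 1ₛ)) n   ≈⟨ *ₛ-constantˡ a (B +ₛ -ₛ 1ₛ) n ⟩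
    a * (B n + - 1ₛ n)                 ≈⟨ *-congˡ (+-congʳ B≈B′) ⟩
    a * (B′ n + - 1ₛ n)                ≈⟨ *ₛ-constantˡ a (B′ +ₛ -ₛ 1ₛ) n ⟨
    (S.constant a *ₛ (B′ +ₛ -ₛ 1ₛ)) n  ∎)

  -- The factor `S.var` delays everything by one: coefficient `suc i` of `B` depends on coefficients
  -- of `A` and `B` up to `i` only. Hence agreement of `A` and `A′` below `l` yields agreement of
  -- `B` and `B′` up to and including `l`.
  IsStep-contracts : ∀ {a A A′ B B′ l} → IsStep a A B → IsStep a A′ B′ →
                     (∀ {i} → i < l → A i ≈ A′ i) → ∀ {n} → n ≤ l → B n ≈ B′ n
  IsStep-contracts {a} {A} {A′} {B} {B′} {l} B≈ B′≈ A≈A′ {n} n≤l = go n n≤l ℕ.≤-refl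
    where
    -- All indices up to `n` are carried along, since the Cauchy product uses every lower
    -- coefficient of `B`.
    go : ∀ n → n ≤ l → ∀ {i} → i ≤ n → B i ≈ B′ i
    go n n≤l {zero} _ = trans (IsStep-zero B≈) (sym (IsStep-zero B′≈))
    go (suc n) n<l {suc i} (s≤s i≤n) = begin
      B (suc i)               ≈⟨ IsStep-suc B≈ i ⟩
      (A *ₛ factor a B) i     ≈⟨ cauchy-cong {A} {A′} i (λ j j≤i → A≈A′ (ℕ.≤-<-trans j≤i (ℕ.≤-<-trans i≤n n<l)))
                                   (λ j j≤i → factor-cong a {B} {B′} j (go n (ℕ.<⇒≤ n<l) (ℕ.≤-trans j≤i i≤n))) ⟩
      (A′ *ₛ factor a B′) i   ≈⟨ IsStep-suc B′≈ i ⟨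
      B′ (suc i)              ∎

  reciprocal-IsStep : ∀ {a A B D} u v → B ≈ₛ (1ₛ +ₛ -ₛ (S.var *ₛ S.recip D v)) →
                      D ≈ₛ (S.var *ₛ S.constant a +ₛ -ₛ S.recip A u) → IsStep a A B
  reciprocal-IsStep {a} {A} {B} {D} u v B≈ D≈ = isStep λ n → begin
    B n                                                   ≈⟨ B≈ n ⟩
    (1ₛ +ₛ -ₛ (S.var *ₛ E)) n
      ≈⟨ clear-denominators ringₛ {S.var} {S.constant a} {A} (*-recip A u) D≈ (*-recip D v) n ⟩
    1ₛ n + (S.var *ₛ (A *ₛ factor a (1ₛ +ₛ -ₛ (S.var *ₛ E)))) n
      ≈⟨ +-congˡ (Sᵣ.*-cong {S.var} {S.var} (λ _ → refl) (Sᵣ.*-cong {A} {A} (λ _ → refl)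
           (λ i → factor-cong a {B} {1ₛ +ₛ -ₛ (S.var *ₛ E)} i (B≈ i))) n) ⟨
    1ₛ n + (S.var *ₛ (A *ₛ factor a B)) n                 ∎
    where
    ringₛ : CommutativeRing c ℓ
    ringₛ = record { isCommutativeRing = isCommutativeRingₛ }
    module Sᵣ = CommutativeRing ringₛ
    E = S.recip D v

  module _ (a : ℕ → Carrier) (G : ℕ → S.Series) (G-IsStep : ∀ i → IsStep (a i) (G (suc i)) (G i))
           (T : ℕ → ℕ → S.Series) (T-IsStep : ∀ i l → IsStep (a i) (T (suc i) l) (T i (suc l))) where

    -- Each level gains one coefficient over the level below it; at `l = 0` there is no coefficient
    -- to compare.
    IsStep-approximates : ∀ l i {n} → n < l → T i l n ≈ G i n
    IsStep-approximates (suc l) i n<1+l =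
      IsStep-contracts (T-IsStep i l) (G-IsStep i) (IsStep-approximates l (suc i)) (ℕ.≤-pred n<1+l)

-- Weight enumerators of lists

products : {A : Set} → (A → A → A) → (ℕ → List A) → ∀ n → Fin (suc n) → List A
products _◇_ W n i = cartesianProductWith _◇_ (W (toℕ i)) (W (n ∸ toℕ i))

module Enumerator {c ℓ : Level} (R : RawRing c ℓ)
  (isCommutativeRing : IsCommutativeRing (RawRing._≈_ R) (RawRing._+_ R) (RawRing._*_ R)
                         (RawRing.-_ R) (RawRing.0# R) (RawRing.1# R)) (q : RawRing.Carrier R) where

  open SeriesRing R isCommutativeRing
  open CommutativeRing commutativeRing hiding (isCommutativeRing; zero)
  open Algebra.Properties.CommutativeSemigroup +-commutativeSemigroup using (x∙yz≈y∙xz)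
  open Algebra.Properties.Semiring.Exp semiring using (_^_; ^-homo-*)
  open import Algebra.Definitions.RawSemiring (RawRing.rawSemiring R) using (sum)
  open Relation.Binary.Reasoning.Setoid setoid

  private variable
    A B C : Set

  enumerate : (A → ℕ) → List A → Carrier
  enumerate s = foldr (λ a p → q ^ s a + p) 0#

  enumerate-++ : ∀ (s : A → ℕ) xs ys → enumerate s (xs ++ ys) ≈ enumerate s xs + enumerate s ys
  enumerate-++ s []       ys = sym (+-identityˡ _)
  enumerate-++ s (x ∷ xs) ys = trans (+-congˡ (enumerate-++ s xs ys)) (sym (+-assoc _ _ _))

  enumerate-↭ : ∀ (s : A → ℕ) {xs ys} → xs ↭ ys → enumerate s xs ≈ enumerate s ys
  enumerate-↭ s ↭.refl         = refl
  enumerate-↭ s (↭.prep x p)   = +-congˡ (enumerate-↭ s p)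
  enumerate-↭ s (↭.swap x y p) = trans (x∙yz≈y∙xz _ _ _) (+-congˡ (+-congˡ (enumerate-↭ s p)))
  enumerate-↭ s (↭.trans p p′) = trans (enumerate-↭ s p) (enumerate-↭ s p′)

  enumerate-map : ∀ (s : B → ℕ) (g : A → B) xs → enumerate s (map g xs) ≡ enumerate (s ∘ g) xs
  enumerate-map s g []       = ≡.refl
  enumerate-map s g (x ∷ xs) = ≡.cong (q ^ s (g x) +_) (enumerate-map s g xs)

  enumerate-shift : ∀ {s t : A → ℕ} d xs → (∀ {a} → a ∈ xs → s a ≡ d ℕ.+ t a) →
                    enumerate s xs ≈ q ^ d * enumerate t xs
  enumerate-shift         d []       s≡d+t = sym (zeroʳ _)
  enumerate-shift {s = s} {t} d (x ∷ xs) s≡d+t = begin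
    q ^ s x + enumerate s xs                  ≈⟨ +-cong (reflexive (≡.cong (q ^_) (s≡d+t (here ≡.refl))))
                                                   (enumerate-shift {s = s} {t} d xs (s≡d+t ∘ there)) ⟩
    q ^ (d ℕ.+ t x) + q ^ d * enumerate t xs  ≈⟨ +-congʳ (^-homo-* q d (t x)) ⟩
    q ^ d * q ^ t x + q ^ d * enumerate t xs  ≈⟨ distribˡ _ _ _ ⟨
    q ^ d * (q ^ t x + enumerate t xs)        ∎

  -- Exponents add, so powers of `q` multiply. Additivity is asked of list members only, because
  -- `statistic-◇` needs words whose letters are bounded by their length.
  enumerate-cartesianProductWith :
    ∀ {s : C → ℕ} {t : A → ℕ} {u : B → ℕ} (g : A → B → C) xs ys →
    (∀ {a b} → a ∈ xs → b ∈ ys → s (g a b) ≡ t a ℕ.+ u b) →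
    enumerate s (cartesianProductWith g xs ys) ≈ enumerate t xs * enumerate u ys
  enumerate-cartesianProductWith g []       ys s≡t+u = sym (zeroˡ _)
  enumerate-cartesianProductWith {s = s} {t} {u} g (x ∷ xs) ys s≡t+u = begin
    enumerate s (map (g x) ys ++ cartesianProductWith g xs ys)
      ≈⟨ enumerate-++ s (map (g x) ys) _ ⟩
    enumerate s (map (g x) ys) + enumerate s (cartesianProductWith g xs ys)
      ≈⟨ +-cong (trans (reflexive (enumerate-map s (g x) ys))
                       (enumerate-shift {s = s ∘ g x} {u} (t x) ys (s≡t+u (here ≡.refl))))
                (enumerate-cartesianProductWith {s = s} {t} {u} g xs ys (s≡t+u ∘ there)) ⟩
    q ^ t x * enumerate u ys + enumerate t xs * enumerate u ys
      ≈⟨ distribʳ _ _ _ ⟨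
    (q ^ t x + enumerate t xs) * enumerate u ys
      ∎

  enumerate-concat-tabulate : ∀ (s : A → ℕ) {n} (g : Fin n → List A) {h : Fin n → Carrier} →
                              (∀ i → enumerate s (g i) ≈ h i) →
                              enumerate s (concat (tabulate g)) ≈ sum h
  enumerate-concat-tabulate s {zero}  g g≈h = refl
  enumerate-concat-tabulate s {suc n} g g≈h = trans (enumerate-++ s (g zero) _)
    (+-cong (g≈h zero) (enumerate-concat-tabulate s (g ∘ suc) (g≈h ∘ suc)))

  -- `t` weighs left parts and `u` right parts, so the decomposition gives a Cauchy product of their
  -- enumerators. As `ε` is the only object of size 0 and `u` exceeds `s` by `d` on all others, the
  -- enumerator of `u` is the `factor` of that of `s`.
  enumerate-IsStep :
    ∀ (W : ℕ → List A) {ε} (_◇_ : A → A → A) {s t u : A → ℕ} {d} →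
    W 0 ≡ ε ∷ [] →
    (∀ n → W (suc n) ↭ concat (tabulate (products _◇_ W n))) →
    s ε ≡ 0 →
    (∀ {m n a b} → a ∈ W m → b ∈ W n → s (a ◇ b) ≡ t a ℕ.+ u b) →
    u ε ≡ 0 →
    (∀ {n b} → b ∈ W (suc n) → u b ≡ d ℕ.+ s b) →
    IsStep (q ^ d) (enumerate t ∘ W) (enumerate s ∘ W)
  enumerate-IsStep W {ε} _◇_ {s} {t} {u} {d} W₀ W-suc sε s-◇ uε u-suc = IsStep-intro (at-0 s sε) λ n → begin
    enumerate s (W (suc n))
      ≈⟨ enumerate-↭ s (W-suc n) ⟩
    enumerate s (concat (tabulate (products _◇_ W n)))
      ≈⟨ enumerate-concat-tabulate s (products _◇_ W n)
           (λ i → enumerate-cartesianProductWith {s = s} {t} {u} _◇_ (W (toℕ i)) (W (n ∸ toℕ i))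
                   (s-◇ {toℕ i} {n ∸ toℕ i})) ⟩
    S.cauchy (enumerate t ∘ W) (enumerate u ∘ W) n
      ≈⟨ cauchy-cong {enumerate t ∘ W} {enumerate t ∘ W} n (λ _ _ → refl) (λ i _ → u-factor i) ⟩
    S.cauchy (enumerate t ∘ W) (factor (q ^ d) (enumerate s ∘ W)) n
      ∎
    where
    module S = PowerSeries R
    at-0 : ∀ (v : _ → ℕ) → v ε ≡ 0 → enumerate v (W 0) ≈ 1#
    at-0 v vε = begin
      enumerate v (W 0)  ≡⟨ ≡.cong (enumerate v) W₀ ⟩
      q ^ v ε + 0#       ≈⟨ +-identityʳ _ ⟩
      q ^ v ε            ≡⟨ ≡.cong (q ^_) vε ⟩
      1#                 ∎

    u-factor : ∀ i → enumerate u (W i) ≈ factor (q ^ d) (enumerate s ∘ W) i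
    u-factor i = trans (go i) (+-congˡ (sym (*ₛ-constantˡ (q ^ d) (λ j → enumerate s (W j) + - S.constant 1# j) i)))
      where
      go : ∀ i → enumerate u (W i) ≈ S.constant 1# i + q ^ d * (enumerate s (W i) + - S.constant 1# i)
      go zero    = begin
        enumerate u (W 0)                            ≈⟨ at-0 u uε ⟩
        1#                                           ≈⟨ +-identityʳ 1# ⟨
        1# + 0#                                      ≈⟨ +-congˡ (zeroʳ (q ^ d)) ⟨
        1# + q ^ d * 0#                              ≈⟨ +-congˡ (*-congˡ (-‿inverseʳ 1#)) ⟨
        1# + q ^ d * (1# + - 1#)                     ≈⟨ +-congˡ (*-congˡ (+-congʳ (at-0 s sε))) ⟨
        1# + q ^ d * (enumerate s (W 0) + - 1#)      ∎
      go (suc i) = begin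
        enumerate u (W (suc i))                      ≈⟨ enumerate-shift {s = u} {s} d (W (suc i)) u-suc ⟩
        q ^ d * enumerate s (W (suc i))              ≈⟨ *-congˡ (+-identityʳ _) ⟨
        q ^ d * (enumerate s (W (suc i)) + 0#)       ≈⟨ *-congˡ (+-congˡ -0#≈0#) ⟨
        q ^ d * (enumerate s (W (suc i)) + - 0#)     ≈⟨ +-identityˡ _ ⟨
        0# + q ^ d * (enumerate s (W (suc i)) + - 0#)  ∎
        where open Algebra.Properties.Ring ring using (-0#≈0#)

-- The continued fraction over ℤ[y]

module ℤ-series = SeriesRing ℤ.+-*-rawRing ℤ.+-*-isCommutativeRing

-- `coeff` embeds ℤ[y] into ℤ⟦y⟧.
ℤ[y]-isCommutativeRing : IsCommutativeRing (RawRing._≈_ ℤ[y]) (RawRing._+_ ℤ[y]) (RawRing._*_ ℤ[y])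
                           (RawRing.-_ ℤ[y]) (RawRing.0# ℤ[y]) (RawRing.1# ℤ[y])
ℤ[y]-isCommutativeRing = RingMonomorphism.isCommutativeRing coeff-isRingMonomorphism ℤ-series.isCommutativeRingₛ
  where
  coeff-isRingMonomorphism : IsRingMonomorphism ℤ[y] (PowerSeries.seriesRing ℤ.+-*-rawRing) coeff
  coeff-isRingMonomorphism = record
    { isRingHomomorphism = record
      { isSemiringHomomorphism = record
        { isNearSemiringHomomorphism = record
          { +-isMonoidHomomorphism = record
            { isMagmaHomomorphism = record
              { isRelHomomorphism = record { cong = λ p≈q → p≈q }
              ; homo = λ _ _ _ → ≡.refl
              }
            ; ε-homo = λ _ → ≡.refl
            }
          ; *-homo = λ _ _ _ → ≡.refl
          }
        ; 1#-homo = λ _ → ≡.refl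
        }
      ; -‿homo = λ _ _ → ≡.refl
      }
    ; injective = λ p≈q → p≈q
    }

module SR = SeriesRing ℤ[y] ℤ[y]-isCommutativeRing

open import Algebra.Definitions.RawSemiring (RawRing.rawSemiring ℤ[y]) using (_^_)

step-IsStep : ∀ d A → SR.IsStep (y ^ d) (proj₁ A) (proj₁ (step d A))
step-IsStep d (A , A₀≈1) = SR.reciprocal-IsStep {y ^ d} {A} (+1# A₀≈1) _ (λ _ _ → ≡.refl) (λ _ _ → ≡.refl)

tail-IsStep : ∀ d i l → SR.IsStep (y ^ d i) (proj₁ (tail d (suc i) l)) (proj₁ (tail d i (suc l)))
tail-IsStep d i l = step-IsStep (d i) (tail d (suc i) l)

-- The indices are shifted by one: `G e` is the limit of the tails that start at place `suc e`, as
-- the fraction starts at place 1.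
convergent-converges : ∀ d (G : ℕ → Series) → (∀ i → SR.IsStep (y ^ d (suc i)) (G (suc i)) (G i)) →
                       convergent d ConvergesTo G 0
convergent-converges d G G-IsStep N = N , λ m N≤m n n<N →
  SR.IsStep-approximates (λ i → y ^ d (suc i)) G G-IsStep (λ i l → proj₁ (tail d (suc i) l))
    (λ i l → tail-IsStep d (suc i) l) m 0 (ℕ.<-≤-trans n<N N≤m)

open import Data.Nat.Base using (_+_)
open import Relation.Binary.PropositionalEquality using (refl; sym; trans; cong; cong₂; subst; module ≡-Reasoning)
open import Data.List.Membership.DecPropositional ℕ._≟_ using (_∈?_)
open Algebra.Properties.Monoid.Sum ℕ.+-0-monoid using (sum; sum-cong-≗; sum-replicate-zero)

-- Words of natural numbers

-- With letters counted from 0, the largest letter of the result is `length L + length R`, and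
-- raising `L` by `length R` makes room for `R` below it.
_◇_ : List ℕ → List ℕ → List ℕ
L ◇ R = map (length R +_) L ++ (length L + length R) ∷ R

-- The number of increasing subsequences of length j with all letters above a.
increasing : ℕ → ℕ → List ℕ → ℕ
increasing zero    a w       = 1
increasing (suc j) a []      = 0
increasing (suc j) a (b ∷ w) = (if a <ᵇ b then increasing j b w else 0) + increasing (suc j) a w

-- The occurrences of 21-3-⋯-(j+2) in a ∷ w that start with a.
descentsAt : ℕ → ℕ → List ℕ → ℕ
descentsAt j a []      = 0
descentsAt j a (b ∷ w) = if b <ᵇ a then increasing j a w else 0

descents : ℕ → List ℕ → ℕ
descents j []      = 0
descents j (a ∷ w) = descentsAt j a w + descents j w

-- ∑ⱼ (e choose j) · descents (K - j), unfolded by Pascal's rule.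
statistic : ℕ → ℕ → List ℕ → ℕ
statistic zero    K       w = descents K w
statistic (suc e) zero    w = statistic e zero w
statistic (suc e) (suc K) w = statistic e K w + statistic e (suc K) w

ifNonempty : ℕ → List ℕ → ℕ
ifNonempty d []      = 0
ifNonempty d (_ ∷ _) = d

<ᵇ-true : ∀ {a b} → a < b → (a <ᵇ b) ≡ true
<ᵇ-true {a} {b} = dec-true (a ℕ.<? b)

<ᵇ-false : ∀ {a b} → b ≤ a → (a <ᵇ b) ≡ false
<ᵇ-false {a} {b} b≤a = dec-false (a ℕ.<? b) (ℕ.≤⇒≯ b≤a)

<ᵇ-+ : ∀ c a b → (c + a <ᵇ c + b) ≡ (a <ᵇ b)
<ᵇ-+ zero    a b = refl
<ᵇ-+ (suc c) a b = <ᵇ-+ c a b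

increasing-shift : ∀ j c a w → increasing j (c + a) (map (c +_) w) ≡ increasing j a w
increasing-shift zero    c a w       = refl
increasing-shift (suc j) c a []      = refl
increasing-shift (suc j) c a (b ∷ w)
  rewrite <ᵇ-+ c a b | increasing-shift j c b w | increasing-shift (suc j) c a w = refl

descentsAt-shift : ∀ j c a w → descentsAt j (c + a) (map (c +_) w) ≡ descentsAt j a w
descentsAt-shift j c a []      = refl
descentsAt-shift j c a (b ∷ w) rewrite <ᵇ-+ c b a | increasing-shift j c a w = refl

descents-shift : ∀ j c w → descents j (map (c +_) w) ≡ descents j w
descents-shift j c []      = refl
descents-shift j c (a ∷ w) = cong₂ _+_ (descentsAt-shift j c a w) (descents-shift j c w)

statistic-shift : ∀ e K c w → statistic e K (map (c +_) w) ≡ statistic e K w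
statistic-shift zero    K       c w = descents-shift K c w
statistic-shift (suc e) zero    c w = statistic-shift e zero c w
statistic-shift (suc e) (suc K) c w = cong₂ _+_ (statistic-shift e K c w) (statistic-shift e (suc K) c w)

-- The right side is a uniform way to write 1 for `j = 0` and 0 otherwise.
increasing-below : ∀ j {a} b {w} → All (_≤ a) w → increasing j a w ≡ increasing j b []
increasing-below zero    b w≤a = refl
increasing-below (suc j) b []  = refl
increasing-below (suc j) b (c≤a ∷ w≤a) rewrite <ᵇ-false c≤a = increasing-below (suc j) b w≤a

-- A descent that starts at the maximum finds no larger letter to continue with, so it contributes
-- to the pattern `21` alone.
descentsAt-max-suc : ∀ j {m R} → All (_< m) R → descentsAt (suc j) m R ≡ 0
descentsAt-max-suc j     []          = refl
descentsAt-max-suc j {m} (b<m ∷ w<m) rewrite <ᵇ-true b<m = increasing-below (suc j) m (All.map ℕ.<⇒≤ w<m)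

descentsAt-max-zero : ∀ {m R} → All (_< m) R → descentsAt 0 m R ≡ ifNonempty 1 R
descentsAt-max-zero []        = refl
descentsAt-max-zero (b<m ∷ _) rewrite <ᵇ-true b<m = refl

-- Statistics of a word split at its largest letter

Between : List ℕ → ℕ → ℕ → Set
Between R m a = All (_< a) R × a < m

module _ {m : ℕ} {R : List ℕ} (R<m : All (_< m) R) where

  -- The letters of `R` lie below `a`, and `m` exceeds everything: a subsequence that uses `m` must
  -- end with it, and one that does not stays inside `w`.
  increasing-++ : ∀ j {a w} → Between R m a → All (Between R m) w →
                  increasing (suc j) a (w ++ m ∷ R) ≡ increasing j a w + increasing (suc j) a w
  increasing-++ j {a} (R<a , a<m) []
    rewrite <ᵇ-true a<m | increasing-below j a (All.map ℕ.<⇒≤ R<m)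
          | increasing-below (suc j) a (All.map ℕ.<⇒≤ R<a) = refl
  -- A separate case, since `increasing 0` is constantly 1 and does not recurse on the word: `m`
  -- alone is the one new subsequence, whether or not `a < b`.
  increasing-++ zero {a} {b ∷ w} a∈ (b∈ ∷ w∈) = begin
    β 1 + increasing 1 a (w ++ m ∷ R)  ≡⟨ cong (β 1 +_) (increasing-++ zero a∈ w∈) ⟩
    β 1 + (1 + increasing 1 a w)       ≡⟨ ℕ.+-suc (β 1) _ ⟩
    1 + (β 1 + increasing 1 a w)       ∎
    where
    open ≡-Reasoning
    β : ℕ → ℕ
    β z = if a <ᵇ b then z else 0
  increasing-++ (suc j) {a} {b ∷ w} a∈ (b∈ ∷ w∈) with a <ᵇ b
  ... | false = increasing-++ (suc j) a∈ w∈
  ... | true  rewrite increasing-++ j b∈ w∈ | increasing-++ (suc j) a∈ w∈ =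
    interchange (increasing j b w) (increasing (suc j) b w) (increasing (suc j) a w) (increasing (suc (suc j)) a w)
    where
    interchange : ∀ p q r s → (p + q) + (r + s) ≡ (p + r) + (q + s)
    interchange = solve-∀

  -- The descent itself must lie inside `a ∷ w`, because `a` followed by `m` ascends; only its
  -- increasing continuation can reach `m`.
  descentsAt-++-suc : ∀ j {a w} → Between R m a → All (Between R m) w →
                      descentsAt (suc j) a (w ++ m ∷ R) ≡ descentsAt j a w + descentsAt (suc j) a w
  descentsAt-++-suc j {a} (_ , a<m) [] rewrite <ᵇ-false (ℕ.<⇒≤ a<m) = refl
  descentsAt-++-suc j {a} {b ∷ w} a∈ (b∈ ∷ w∈) with b <ᵇ a
  ... | false = refl
  ... | true  = increasing-++ j a∈ w∈

  descentsAt-++-zero : ∀ {a w} → Between R m a → All (Between R m) w →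
                       descentsAt 0 a (w ++ m ∷ R) ≡ descentsAt 0 a w
  descentsAt-++-zero (_ , a<m) [] rewrite <ᵇ-false (ℕ.<⇒≤ a<m) = refl
  descentsAt-++-zero a∈ (b∈ ∷ w∈) = refl

  descents-++-suc : ∀ j {w} → All (Between R m) w →
                    descents (suc j) (w ++ m ∷ R) ≡ (descents j w + descents (suc j) w) + descents (suc j) R
  descents-++-suc j []       = cong (_+ descents (suc j) R) (descentsAt-max-suc j R<m)
  descents-++-suc j {a ∷ w} (a∈ ∷ w∈) rewrite descentsAt-++-suc j a∈ w∈ | descents-++-suc j w∈ =
    regroup (descentsAt j a w) (descentsAt (suc j) a w) (descents j w) (descents (suc j) w) (descents (suc j) R)
    where
    regroup : ∀ p q r s t → (p + q) + ((r + s) + t) ≡ ((p + r) + (q + s)) + t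
    regroup = solve-∀

  descents-++-zero : ∀ {w} → All (Between R m) w →
                     descents 0 (w ++ m ∷ R) ≡ descents 0 w + (ifNonempty 1 R + descents 0 R)
  descents-++-zero []       = cong (_+ descents 0 R) (descentsAt-max-zero R<m)
  descents-++-zero {a ∷ w} (a∈ ∷ w∈) rewrite descentsAt-++-zero a∈ w∈ | descents-++-zero w∈ =
    sym (ℕ.+-assoc (descentsAt 0 a w) _ _)

  -- At `e = 0` the rise to `suc e` records the occurrences ending in `m`, since
  -- `statistic 1 (suc K)` is `descents K` plus `descents (suc K)`, and `0 C K` records the descent
  -- that starts at `m`, present for `K = 0` only. Pascal's rule, for `statistic` and for the
  -- binomials alike, carries this to every `e`.
  statistic-++ : ∀ e K {w} → All (Between R m) w →
                 statistic e K (w ++ m ∷ R) ≡ statistic (suc e) K w + (ifNonempty (e C K) R + statistic e K R)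
  statistic-++ zero    zero    w∈ = descents-++-zero w∈
  statistic-++ zero    (suc K) {w} w∈ = trans (descents-++-suc K w∈)
    (cong (λ z → (descents K w + descents (suc K) w) + (z + descents (suc K) R)) (sym (ifNonempty-zero R)))
    where
    ifNonempty-zero : ∀ R → ifNonempty 0 R ≡ 0
    ifNonempty-zero []      = refl
    ifNonempty-zero (_ ∷ _) = refl
  statistic-++ (suc e) zero    w∈ = statistic-++ e zero w∈
  statistic-++ (suc e) (suc K) {w} w∈ = begin
    statistic e K (w ++ m ∷ R) + statistic e (suc K) (w ++ m ∷ R)
      ≡⟨ cong₂ _+_ (statistic-++ e K w∈) (statistic-++ e (suc K) w∈) ⟩
    (statistic (suc e) K w + (ifNonempty (e C K) R + statistic e K R)) +
      (statistic (suc e) (suc K) w + (ifNonempty (e C suc K) R + statistic e (suc K) R))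
      ≡⟨ regroup (statistic (suc e) K w) (ifNonempty (e C K) R) (statistic e K R)
                 (statistic (suc e) (suc K) w) (ifNonempty (e C suc K) R) (statistic e (suc K) R) ⟩
    (statistic (suc e) K w + statistic (suc e) (suc K) w) +
      ((ifNonempty (e C K) R + ifNonempty (e C suc K) R) + (statistic e K R + statistic e (suc K) R))
      ≡⟨ cong (λ z → (statistic (suc e) K w + statistic (suc e) (suc K) w) + (z + (statistic e K R + statistic e (suc K) R)))
              (pascal R) ⟩
    (statistic (suc e) K w + statistic (suc e) (suc K) w) +
      (ifNonempty (suc e C suc K) R + (statistic e K R + statistic e (suc K) R))
      ∎
    where
    open ≡-Reasoning
    regroup : ∀ p q r s t u → (p + (q + r)) + (s + (t + u)) ≡ (p + s) + ((q + t) + (r + u))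
    regroup = solve-∀
    pascal : ∀ R → ifNonempty (e C K) R + ifNonempty (e C suc K) R ≡ ifNonempty (suc e C suc K) R
    pascal []      = refl
    pascal (_ ∷ _) = nCk+nC[k+1]≡[n+1]C[k+1] e K

shifted-between : ∀ {L R} → All (_< length L) L → All (_< length R) R →
                  All (Between R (length L + length R)) (map (length R +_) L)
shifted-between {L} {R} L< R< = All.map⁺ (All.map (λ {a} a<|L| →
    All.map (λ r< → ℕ.<-≤-trans r< (ℕ.m≤m+n _ a)) R<
  , ℕ.<-≤-trans (ℕ.+-monoʳ-< (length R) a<|L|) (ℕ.≤-reflexive (ℕ.+-comm (length R) _))) L<)

statistic-◇ : ∀ e K {L R} → All (_< length L) L → All (_< length R) R →
              statistic e K (L ◇ R) ≡ statistic (suc e) K L + (ifNonempty (e C K) R + statistic e K R)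
statistic-◇ e K {L} {R} L< R< = trans
  (statistic-++ (All.map (λ r< → ℕ.<-≤-trans r< (ℕ.m≤n+m _ _)) R<) e K (shifted-between L< R<))
  (cong (_+ (ifNonempty (e C K) R + statistic e K R)) (statistic-shift (suc e) K (length R) L))

-- Pigeonhole

length-mono-⊆ : ∀ {A : Set} {xs ys : List A} → Unique xs → xs ⊆ ys → length xs ≤ length ys
length-mono-⊆ [] xs⊆ys = z≤n
length-mono-⊆ {xs = x ∷ xs} (x∉xs ∷ xs!) xs⊆ys with as , bs , refl ← ∈-∃++ (xs⊆ys (here refl)) = begin
  suc (length xs)          ≤⟨ s≤s (length-mono-⊆ xs! xs⊆as++bs) ⟩
  suc (length (as ++ bs))  ≡⟨ cong suc (List.length-++ as) ⟩
  suc (length as + length bs)  ≡⟨ ℕ.+-suc _ _ ⟨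
  length as + length (x ∷ bs)  ≡⟨ List.length-++ as ⟨
  length (as ++ x ∷ bs)    ∎
  where
  open ℕ.≤-Reasoning
  xs⊆as++bs : xs ⊆ as ++ bs
  xs⊆as++bs {v} v∈xs with ∈-++⁻ as (xs⊆ys (there v∈xs))
  ... | inj₁ v∈as          = ∈-++⁺ˡ v∈as
  ... | inj₂ (here refl)   = ⊥-elim (All.lookup x∉xs v∈xs refl)
  ... | inj₂ (there v∈bs)  = ∈-++⁺ʳ as v∈bs

length-≤-bound : ∀ {n w} → Unique w → All (_< n) w → length w ≤ n
length-≤-bound {n} {w} w! w<n = subst (length w ≤_) (List.length-upTo n)
  (length-mono-⊆ w! λ v∈w → ∈-upTo⁺ (All.lookup w<n v∈w))

-- A missing `i` could be prepended, which would give `suc n` distinct letters below `n`.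
∈-full : ∀ {n w} → Unique w → All (_< n) w → length w ≡ n → ∀ {i} → i < n → i ∈ w
∈-full {n} {w} w! w<n |w|≡n {i} i<n with i ∈? w
... | yes i∈w = i∈w
... | no  i∉w = ⊥-elim (ℕ.<-irrefl |w|≡n
  (length-≤-bound (All.¬Any⇒All¬ w i∉w ∷ w!) (i<n ∷ w<n)))

AllPairs-++⁻ : ∀ {a ℓ} {A : Set a} {P : Rel A ℓ} xs {ys} → AllPairs P (xs ++ ys) →
               AllPairs P xs × AllPairs P ys × All (λ x → All (P x) ys) xs
AllPairs-++⁻ []       p = [] , p , []
AllPairs-++⁻ (x ∷ xs) (px ∷ p) with pxs , pys , pxys ← AllPairs-++⁻ xs p =
  All.++⁻ˡ xs px ∷ pxs , pys , All.++⁻ʳ xs px ∷ pxys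

-- 1-3-2-avoidance

-- `a`, `b`, `c` play the parts of 1, 3, 2; fixing the smallest letter as the head makes the
-- condition recursive on the word.
Avoids : List ℕ → Set
Avoids []      = ⊤
Avoids (a ∷ w) = AllPairs (λ b c → ¬ (a < c × c < b)) w × Avoids w

Avoids-map⁺ : ∀ c w → Avoids w → Avoids (map (c +_) w)
Avoids-map⁺ c []      _         = tt
Avoids-map⁺ c (a ∷ w) (p , w-av) =
  AllPairs.map⁺ (AllPairs.map (λ ¬p (q , r) → ¬p (ℕ.+-cancelˡ-< c _ _ q , ℕ.+-cancelˡ-< c _ _ r)) p) , Avoids-map⁺ c w w-av

Avoids-map⁻ : ∀ c w → Avoids (map (c +_) w) → Avoids w
Avoids-map⁻ c []      _         = tt
Avoids-map⁻ c (a ∷ w) (p , w-av) =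
  AllPairs.map (λ ¬p (q , r) → ¬p (ℕ.+-monoʳ-< c q , ℕ.+-monoʳ-< c r)) (AllPairs.map⁻ p) , Avoids-map⁻ c w w-av

-- A letter of `R` cannot be the 2 for a 1 in `w`, being smaller, and `m` can be neither the 1 nor
-- the 2, being the maximum.
Avoids-++⁺ : ∀ {m R} (R<m : All (_< m) R) → Avoids R → ∀ {w} → All (Between R m) w → Avoids w → Avoids (w ++ m ∷ R)
Avoids-++⁺ {m} {R} R<m R-av [] _ = all-pairs R<m , R-av
  where
  all-pairs : ∀ {R} → All (_< m) R → AllPairs (λ b c → ¬ (m < c × c < b)) R
  all-pairs []          = []
  all-pairs (_ ∷ R<m) = All.map (λ c<m (m<c , _) → ℕ.<-asym c<m m<c) R<m ∷ all-pairs R<m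
Avoids-++⁺ {m} {R} R<m R-av {a ∷ w} ((R<a , a<m) ∷ w∈) (p , w-av) =
  AllPairs.++⁺ p (no-R ∷ all-pairs R<a) (All.map (λ (_ , b<m) → (λ (_ , m<b) → ℕ.<-asym b<m m<b) ∷ no-R) w∈)
  , Avoids-++⁺ R<m R-av w∈ w-av
  where
  no-R : ∀ {b} → All (λ c → ¬ (a < c × c < b)) R
  no-R = All.map (λ c<a (a<c , _) → ℕ.<-asym c<a a<c) R<a
  all-pairs : ∀ {R} → All (_< a) R → AllPairs (λ b c → ¬ (a < c × c < b)) R
  all-pairs []        = []
  all-pairs (_ ∷ R<a) = All.map (λ c<a (a<c , _) → ℕ.<-asym c<a a<c) R<a ∷ all-pairs R<a

-- The last component excludes `a m c` as a 1-3-2; for a maximal `m` it forces the left letters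
-- above the right ones.
Avoids-++⁻ : ∀ L {m R} → Avoids (L ++ m ∷ R) → Avoids L × Avoids R × All (λ a → All (λ c → ¬ (a < c × c < m)) R) L
Avoids-++⁻ []      (_ , R-av) = tt , R-av , []
Avoids-++⁻ (a ∷ L) (p , av) with L-av , R-av , cross ← Avoids-++⁻ L av | pL , (pmR ∷ _) , _ ← AllPairs-++⁻ L p =
  (pL , L-av) , R-av , (pmR ∷ cross)

-- Splitting an avoider at its largest letter

record Avoider (n : ℕ) (w : List ℕ) : Set where
  constructor avoider
  field
    size    : length w ≡ n
    bounded : All (_< n) w
    unique  : Unique w
    avoids  : Avoids w

open Avoider

length-◇ : ∀ L R → length (L ◇ R) ≡ suc (length L + length R)
length-◇ L R = trans (List.length-++ (map (length R +_) L))
  (trans (cong (_+ suc (length R)) (List.length-map _ L)) (ℕ.+-suc _ _))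

module _ {L R : List ℕ} (L-av : Avoider (length L) L) (R-av : Avoider (length R) R) where

  private
    m = length L + length R

    R<m : All (_< m) R
    R<m = All.map (λ r< → ℕ.<-≤-trans r< (ℕ.m≤n+m _ _)) (bounded R-av)

    between : All (Between R m) (map (length R +_) L)
    between = shifted-between (bounded L-av) (bounded R-av)

  ◇-avoider : Avoider (suc (length L + length R)) (L ◇ R)
  ◇-avoider = record
    { size    = length-◇ L R
    ; bounded = All.++⁺ (All.map (λ (_ , a<m) → ℕ.m<n⇒m<1+n a<m) between) (ℕ.≤-refl ∷ All.map ℕ.m<n⇒m<1+n R<m)
    ; unique  = AllPairs.++⁺ (Unique.map⁺ (ℕ.+-cancelˡ-≡ _ _ _) (unique L-av))
                  (All.map ℕ.>⇒≢ R<m ∷ unique R-av)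
                  (All.map (λ (R<a , a<m) → ℕ.<⇒≢ a<m ∷ All.map ℕ.>⇒≢ R<a) between)
    ; avoids  = Avoids-++⁺ R<m (avoids R-av) between (Avoids-map⁺ _ L (avoids L-av))
    }

map-+-∸ : ∀ {c w} → All (c ≤_) w → map (c +_) (map (_∸ c) w) ≡ w
map-+-∸ []        = refl
map-+-∸ (c≤a ∷ p) = cong₂ _∷_ (ℕ.m+[n∸m]≡n c≤a) (map-+-∸ p)

-- The letter `n` must occur by `∈-full`, and the word is cut there. Avoidance puts `L′` above `R`,
-- so `R` consists of the smallest letters, and lowering `L′` by `length R` standardizes it.
◇-surjective : ∀ {n w} → Avoider (suc n) w →
               ∃₂ λ L R → Avoider (length L) L × Avoider (length R) R × length L + length R ≡ n × w ≡ L ◇ R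
◇-surjective {n} {w} w-av@(avoider |w| w< w! av)
  with L′ , R , refl ← ∈-∃++ (∈-full w! w< |w| ℕ.≤-refl)
  with L′! , (n∉R ∷ R!) , L′≢ ← AllPairs-++⁻ L′ w!
     | L′-av , R-av , cross ← Avoids-++⁻ L′ av
     | L′≤n , (_ ∷ R≤n) ← All.++⁻ L′ w<
  = L , R
  , avoider refl L<|L| (Unique.map⁻ (subst Unique (sym L′≡) L′!)) (Avoids-map⁻ c L (subst Avoids (sym L′≡) L′-av))
  , avoider refl R<|R| R! R-av
  , n≡
  , cong₂ (λ u v → u ++ v ∷ R) (sym L′≡) (sym n≡)
  where
  c = length R
  L = map (_∸ c) L′

  R<n : All (_< n) R
  R<n = All.zipWith (λ (n≢r , r≤n) → ℕ.≤∧≢⇒< (ℕ.≤-pred r≤n) (n≢r ∘ sym)) (n∉R , R≤n)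

  L′-between : All (Between R n) L′
  L′-between = All.tabulate λ {a} a∈ → All.tabulate (λ {r} r∈ → R<a a∈ r∈) , a<n a∈
    where
    a<n : ∀ {a} → a ∈ L′ → a < n
    a<n a∈ = ℕ.≤∧≢⇒< (ℕ.≤-pred (All.lookup L′≤n a∈)) (All.head (All.lookup L′≢ a∈))
    R<a : ∀ {a r} → a ∈ L′ → r ∈ R → r < a
    R<a {a} {r} a∈ r∈ = ℕ.≤∧≢⇒<
      (ℕ.≮⇒≥ λ a<r → All.lookup (All.lookup cross a∈) r∈ (a<r , All.lookup R<n r∈))
      (All.lookup (All.tail (All.lookup L′≢ a∈)) r∈ ∘ sym)

  -- `R` is closed downwards: with `r` it contains all `suc r` letters up to `r`, so
  -- `suc r ≤ length R`.
  R<|R| : All (_< c) R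
  R<|R| = All.tabulate λ {r} r∈ → subst (_≤ c) (List.length-upTo (suc r))
    (length-mono-⊆ (Unique.upTo⁺ (suc r)) λ i∈ → initial r∈ (∈-upTo⁻ i∈))
    where
    initial : ∀ {r i} → r ∈ R → i < suc r → i ∈ R
    initial {r} {i} r∈ (s≤s i≤r) with ∈-++⁻ L′ (∈-full w! w< |w| (s≤s (ℕ.≤-trans i≤r (ℕ.<⇒≤ (All.lookup R<n r∈)))))
    ... | inj₁ i∈L′        = ⊥-elim (ℕ.<⇒≱ (All.lookup (proj₁ (All.lookup L′-between i∈L′)) r∈) i≤r)
    ... | inj₂ (here refl) = ⊥-elim (ℕ.<⇒≱ (All.lookup R<n r∈) i≤r)
    ... | inj₂ (there i∈R) = i∈R

  -- A letter of `L′` exceeds the `c` distinct letters of `R`, hence is at least `c`, and the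
  -- truncated subtraction loses nothing.
  L′≡ : map (c +_) L ≡ L′
  L′≡ = map-+-∸ (All.map (λ (R<a , _) → length-≤-bound R! R<a) L′-between)

  n≡ : length L + c ≡ n
  n≡ = begin
    length L + c   ≡⟨ cong (_+ c) (List.length-map _ L′) ⟩
    length L′ + c  ≡⟨ ℕ.suc-injective (trans (sym (ℕ.+-suc _ _)) (trans (sym (List.length-++ L′)) |w|)) ⟩
    n              ∎
    where open ≡-Reasoning

  L<|L| : All (_< length L) L
  L<|L| = All.map (λ {a} c+a<n → ℕ.+-cancelˡ-< c a _ (ℕ.<-≤-trans c+a<n (ℕ.≤-reflexive (trans (sym n≡) (ℕ.+-comm (length L) c)))))
    (All.map⁻ (subst (All (_< n)) (sym L′≡) (All.map proj₂ L′-between)))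

-- One-line notation

word : ∀ {m n} → Vec (Fin n) m → List ℕ
word π = map toℕ (Vec.toList π)

-- Counting words

count : ∀ {A : Set} {P : A → Set} → Decidable P → List A → ℕ
count P? xs = length (filter P? xs)

count-≐ : ∀ {A : Set} {P Q : A → Set} (P? : Decidable P) (Q? : Decidable Q) → P ≐ Q → ∀ xs → count P? xs ≡ count Q? xs
count-≐ P? Q? P≐Q xs = cong length (List.filter-≐ P? Q? P≐Q xs)

-- Separates the test on the chosen position from the count over the remaining ones, which produces
-- the `if` found in `increasing` and `descentsAt`.
count-×-dec : ∀ {A P : Set} {Q : A → Set} (p? : Dec P) (Q? : Decidable Q) xs →
              count (λ a → p? ×-dec Q? a) xs ≡ (if does p? then count Q? xs else 0)
count-×-dec (yes p) Q? xs = count-≐ _ Q? (proj₂ , (p ,_)) xs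
count-×-dec (no ¬p) Q? xs = cong length (List.filter-none _ (All.universal (λ _ → ¬p ∘ proj₁) xs))

count-map : ∀ {A B : Set} {P : B → Set} (P? : Decidable P) (g : A → B) xs →
            count P? (map g xs) ≡ count (P? ∘ g) xs
count-map P? g []       = refl
count-map P? g (x ∷ xs) with does (P? (g x))
... | true  = cong suc (count-map P? g xs)
... | false = count-map P? g xs

count-++ : ∀ {A : Set} {P : A → Set} (P? : Decidable P) xs ys → count P? (xs ++ ys) ≡ count P? xs + count P? ys
count-++ P? xs ys = trans (cong length (List.filter-++ P? xs ys)) (List.length-++ (filter P? xs))

count-words : ∀ {m n} {P : Vec (Fin n) (suc m) → Set} (P? : Decidable P) →
              count P? (words (suc m) n) ≡ sum (λ i → count (P? ∘ (i ∷_)) (words m n))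
count-words {m} {n} P? = go id
  where
  go : ∀ {l} (g : Fin l → Fin n) →
       count P? (cartesianProductWith _∷_ (tabulate g) (words m n)) ≡ sum (λ i → count (P? ∘ (g i ∷_)) (words m n))
  go {zero}  g = refl
  go {suc l} g = trans (count-++ P? (map (g zero ∷_) (words m n)) _)
    (cong₂ _+_ (count-map P? (g zero ∷_) (words m n)) (go (g ∘ suc)))

-- Sums over the positions of a word

sumSuffixes : (ℕ → List ℕ → ℕ) → List ℕ → ℕ
sumSuffixes G []      = 0
sumSuffixes G (a ∷ w) = G a w + sumSuffixes G w

uncons : (ℕ → List ℕ → ℕ) → List ℕ → ℕ
uncons G []      = 0
uncons G (a ∷ w) = G a w

-- The test `p <ᵇ suc (toℕ q)` means `p ≤ q`; in this form it computes for each constructor of `p`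
-- and `q`, so dropping a letter lowers both.
sum-suffixes : ∀ G {m n} (π : Vec (Fin n) m) p →
  sum (λ q → if p <ᵇ suc (toℕ q) then G (toℕ (lookup π q)) (drop (suc (toℕ q)) (word π)) else 0)
    ≡ sumSuffixes G (drop p (word π))
sum-suffixes G []      zero    = refl
sum-suffixes G []      (suc p) = refl
sum-suffixes G (a ∷ π) zero    = cong (G (toℕ a) (word π) +_) (sum-suffixes G π zero)
sum-suffixes G (a ∷ π) (suc p) = sum-suffixes G π p

-- Adjacency prescribes the position `p`, so at most one summand survives.
sum-uncons : ∀ G {m n} (π : Vec (Fin n) m) p →
  sum (λ q → if toℕ q ≡ᵇ p then G (toℕ (lookup π q)) (drop (suc (toℕ q)) (word π)) else 0)
    ≡ uncons G (drop p (word π))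
sum-uncons G []          zero    = refl
sum-uncons G []          (suc p) = refl
sum-uncons G {suc m} (a ∷ π) zero = trans (cong (G (toℕ a) (word π) +_) (sum-replicate-zero m)) (ℕ.+-identityʳ _)
sum-uncons G (a ∷ π)     (suc p) = sum-uncons G π p

increasing-sumSuffixes : ∀ j v w →
  increasing (suc j) v w ≡ sumSuffixes (λ b w → if v <ᵇ b then increasing j b w else 0) w
increasing-sumSuffixes j v []      = refl
increasing-sumSuffixes j v (b ∷ w) = cong ((if v <ᵇ b then increasing j b w else 0) +_) (increasing-sumSuffixes j v w)

descents-sumSuffixes : ∀ j w → descents j w ≡ sumSuffixes (descentsAt j) w
descents-sumSuffixes j []      = refl
descents-sumSuffixes j (a ∷ w) = cong (descentsAt j a w +_) (descents-sumSuffixes j w)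

descentsAt-uncons : ∀ j a w → descentsAt j a w ≡ uncons (λ b w → if b <ᵇ a then increasing j a w else 0) w
descentsAt-uncons j a []      = refl
descentsAt-uncons j a (b ∷ w) = refl

if-∧ : ∀ a b {z : ℕ} → (if a ∧ b then z else 0) ≡ (if a then (if b then z else 0) else 0)
if-∧ true  b = refl
if-∧ false b = refl

-- Occurrences as increasing sequences of positions

module _ {n : ℕ} (π : Vec (Fin n) n) where

  private
    value : Fin n → ℕ
    value i = toℕ (lookup π i)

  -- `p` is the least admissible position and `v` a strict lower bound for the letter. Passing both
  -- along the chain mirrors the recursion of `increasing` on suffixes.
  Ascending : (p v : ℕ) → ∀ {j} → Vec (Fin n) j → Set
  Ascending p v []       = ⊤
  Ascending p v (q ∷ qs) = (p < suc (toℕ q) × v < value q) × Ascending (suc (toℕ q)) (value q) qs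

  ascending? : ∀ p v {j} → Decidable (Ascending p v {j})
  ascending? p v []       = yes tt
  ascending? p v (q ∷ qs) = (p ℕ.<? suc (toℕ q) ×-dec v ℕ.<? value q) ×-dec ascending? (suc (toℕ q)) (value q) qs

  count-ascending : ∀ j p v → count (ascending? p v) (words j n) ≡ increasing j v (drop p (word π))
  count-ascending zero    p v = refl
  count-ascending (suc j) p v = begin
    count (ascending? p v) (words (suc j) n)
      ≡⟨ count-words (ascending? p v) ⟩
    sum (λ q → count (λ qs → ascending? p v (q ∷ qs)) (words j n))
      ≡⟨ sum-cong-≗ {n} (λ q → trans
           (count-×-dec (p ℕ.<? suc (toℕ q) ×-dec v ℕ.<? value q) (ascending? (suc (toℕ q)) (value q)) (words j n))
           (trans (if-∧ (p <ᵇ suc (toℕ q)) (v <ᵇ value q))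
             (cong (λ z → if p <ᵇ suc (toℕ q) then (if v <ᵇ value q then z else 0) else 0)
               (count-ascending j (suc (toℕ q)) (value q))))) ⟩
    sum (λ q → if p <ᵇ suc (toℕ q) then (if v <ᵇ value q then increasing j (value q) (drop (suc (toℕ q)) (word π))
                                                           else 0) else 0)
      ≡⟨ sum-suffixes (λ b w → if v <ᵇ b then increasing j b w else 0) π p ⟩
    sumSuffixes (λ b w → if v <ᵇ b then increasing j b w else 0) (drop p (word π))
      ≡⟨ increasing-sumSuffixes j v (drop p (word π)) ⟨
    increasing (suc j) v (drop p (word π))
      ∎
    where open ≡-Reasoning

  Ascending-bounds : ∀ {p v j} {qs : Vec (Fin n) j} → Ascending p v qs →
                     ∀ a → p ≤ toℕ (lookup qs a) × v < value (lookup qs a)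
  Ascending-bounds {qs = q ∷ qs} ((p<1+q , v<) , _) zero = ℕ.≤-pred p<1+q , v<
  Ascending-bounds {qs = q ∷ qs} ((p<1+q , v<) , qs↗) (suc a) with q<qsₐ , vq< ← Ascending-bounds qs↗ a =
    ℕ.≤-trans (ℕ.≤-pred p<1+q) (ℕ.<⇒≤ q<qsₐ) , ℕ.<-trans v< vq<

  Ascending-increases : ∀ {p v j} {qs : Vec (Fin n) j} → Ascending p v qs → ∀ a b → a Fin.< b →
                        toℕ (lookup qs a) < toℕ (lookup qs b) × value (lookup qs a) < value (lookup qs b)
  Ascending-increases {qs = q ∷ qs} (_ , qs↗) zero    (suc b) _         = Ascending-bounds qs↗ b
  Ascending-increases {qs = q ∷ qs} (_ , qs↗) (suc a) (suc b) (s≤s a<b) = Ascending-increases qs↗ a b a<b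

  ascending : ∀ {p v j} (qs : Vec (Fin n) j) →
              (∀ a → p ≤ toℕ (lookup qs a) × v < value (lookup qs a)) →
              (∀ a b → a Fin.< b → toℕ (lookup qs a) < toℕ (lookup qs b) × value (lookup qs a) < value (lookup qs b)) →
              Ascending p v qs
  ascending []       bounds increases = tt
  ascending (q ∷ qs) bounds increases = (s≤s (proj₁ (bounds zero)) , proj₂ (bounds zero)) ,
    ascending qs (λ a → increases zero (suc a) (s≤s z≤n)) (λ a b a<b → increases (suc a) (suc b) (s≤s a<b))

  -- Both orders are total and `letters τ` is injective, so preserving the order also reflects it.
  monotone⇒orderIsomorphic : ∀ {k} (τ : Pattern k) (is : Vec (Fin n) k) →
    (∀ a b → letters τ ⟨$⟩ʳ a Fin.< letters τ ⟨$⟩ʳ b → value (lookup is a) < value (lookup is b)) →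
    OrderIsomorphic τ π is
  monotone⇒orderIsomorphic τ is mono a b = mk⇔ (mono a b) reflects
    where
    reflects : value (lookup is a) < value (lookup is b) → letters τ ⟨$⟩ʳ a Fin.< letters τ ⟨$⟩ʳ b
    reflects va<vb with Fin.<-cmp (letters τ ⟨$⟩ʳ a) (letters τ ⟨$⟩ʳ b)
    ... | tri< τa<τb _ _ = τa<τb
    ... | tri> _ _ τb<τa = ⊥-elim (ℕ.<-asym va<vb (mono b a τb<τa))
    ... | tri≈ _ τa≡τb _ = ⊥-elim (ℕ.<-irrefl (cong (value ∘ lookup is) a≡b) va<vb)
      where
      a≡b : a ≡ b
      a≡b = trans (sym (inverseˡ (letters τ))) (trans (cong (letters τ ⟨$⟩ˡ_) τa≡τb) (inverseˡ (letters τ)))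

  module _ {K : ℕ} where

    private
      τ = ⟨21-3-⋯-k⟩ {suc (suc K)} (s≤s (s≤s z≤n))

    -- The later positions must come after `i′`, but their letters are compared with that of `i`,
    -- the larger letter of the descent.
    Occurrence′ : Vec (Fin n) (suc (suc K)) → Set
    Occurrence′ (i ∷ i′ ∷ is) = (toℕ i′ ≡ suc (toℕ i) × value i′ < value i) × Ascending (suc (toℕ i′)) (value i) is

    occurrence′? : Decidable Occurrence′
    occurrence′? (i ∷ i′ ∷ is) =
      (toℕ i′ ℕ.≟ suc (toℕ i) ×-dec value i′ ℕ.<? value i) ×-dec ascending? (suc (toℕ i′)) (value i) is

    occurrence⇒ : ∀ {is} → Occurrence τ π is → Occurrence′ is
    occurrence⇒ {i ∷ i′ ∷ is} (increasing , iso , adjacent) =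
      -- `letters τ` swaps 0 and 1, so the descent is `iso` taken at the positions 1 and 0 in this
      -- order.
      (adjacent zero (suc zero) refl refl , Equivalence.to (iso (suc zero) zero) (s≤s z≤n)) ,
      ascending is
        (λ a → increasing (suc zero) (suc (suc a)) (s≤s (s≤s z≤n)) , Equivalence.to (iso zero (suc (suc a))) (s≤s (s≤s z≤n)))
        (λ a b a<b → increasing (suc (suc a)) (suc (suc b)) (s≤s (s≤s a<b)) ,
                     Equivalence.to (iso (suc (suc a)) (suc (suc b))) (s≤s (s≤s a<b)))

    occurrence⇐ : ∀ {is} → Occurrence′ is → Occurrence τ π is
    occurrence⇐ {i ∷ i′ ∷ is} ((i′≡1+i , vi′<vi) , is↗) = increases , monotone⇒orderIsomorphic τ (i ∷ i′ ∷ is) mono , adjacent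
      where
      i<i′ : toℕ i < toℕ i′
      i<i′ = ℕ.≤-reflexive (sym i′≡1+i)

      increases : Increasing τ π (i ∷ i′ ∷ is)
      increases zero          (suc zero)    _               = i<i′
      increases zero          (suc (suc b)) _               = ℕ.<-trans i<i′ (proj₁ (Ascending-bounds is↗ b))
      increases (suc zero)    (suc (suc b)) _               = proj₁ (Ascending-bounds is↗ b)
      increases (suc zero)    (suc zero)    (s≤s ())
      increases (suc (suc a)) (suc zero)    (s≤s ())
      increases (suc (suc a)) (suc (suc b)) (s≤s (s≤s a<b)) = proj₁ (Ascending-increases is↗ a b a<b)

      mono : ∀ a b → letters τ ⟨$⟩ʳ a Fin.< letters τ ⟨$⟩ʳ b →
             value (lookup (i ∷ i′ ∷ is) a) < value (lookup (i ∷ i′ ∷ is) b)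
      mono zero          zero          (s≤s ())
      mono zero          (suc (suc b)) _               = proj₂ (Ascending-bounds is↗ b)
      mono (suc zero)    zero          _               = vi′<vi
      mono (suc zero)    (suc (suc b)) _               = ℕ.<-trans vi′<vi (proj₂ (Ascending-bounds is↗ b))
      mono (suc (suc a)) zero          (s≤s ())
      mono (suc (suc a)) (suc (suc b)) (s≤s (s≤s a<b)) = proj₂ (Ascending-increases is↗ a b a<b)

      adjacent : RespectsAdjacency τ π (i ∷ i′ ∷ is)
      adjacent zero    (suc zero)    _ _ = i′≡1+i
      adjacent zero    (suc (suc b)) () _
      adjacent (suc a) b             _ ()

    occurrences-descents : occurrences τ π ≡ descents K (word π)
    occurrences-descents = begin
      count (occurrence? τ π) (words (suc (suc K)) n)
        ≡⟨ count-≐ (occurrence? τ π) occurrence′? (occurrence⇒ , occurrence⇐) (words (suc (suc K)) n) ⟩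
      count occurrence′? (words (suc (suc K)) n)
        ≡⟨ count-words occurrence′? ⟩
      sum (λ i → count (λ is → occurrence′? (i ∷ is)) (words (suc K) n))
        ≡⟨ sum-cong-≗ {n} at ⟩
      sum (λ i → descentsAt K (value i) (drop (suc (toℕ i)) (word π)))
        -- At `p = 0` the test computes to `true`, so the sum above carries no condition.
        ≡⟨ sum-suffixes (descentsAt K) π 0 ⟩
      sumSuffixes (descentsAt K) (word π)
        ≡⟨ descents-sumSuffixes K (word π) ⟨
      descents K (word π)
        ∎
      where
      open ≡-Reasoning
      at : ∀ i → count (λ is → occurrence′? (i ∷ is)) (words (suc K) n) ≡ descentsAt K (value i) (drop (suc (toℕ i)) (word π))
      at i = begin
        count (λ is → occurrence′? (i ∷ is)) (words (suc K) n)
          ≡⟨ count-words (λ is → occurrence′? (i ∷ is)) ⟩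
        sum (λ i′ → count (λ is → occurrence′? (i ∷ i′ ∷ is)) (words K n))
          ≡⟨ sum-cong-≗ {n} (λ i′ → trans
               (count-×-dec (toℕ i′ ℕ.≟ suc (toℕ i) ×-dec value i′ ℕ.<? value i)
                            (ascending? (suc (toℕ i′)) (value i)) (words K n))
               (trans (if-∧ (toℕ i′ ≡ᵇ suc (toℕ i)) (value i′ <ᵇ value i))
                 (cong (λ z → if toℕ i′ ≡ᵇ suc (toℕ i) then (if value i′ <ᵇ value i then z else 0) else 0)
                   (count-ascending K (suc (toℕ i′)) (value i))))) ⟩
        sum (λ i′ → if toℕ i′ ≡ᵇ suc (toℕ i)
                      then (if value i′ <ᵇ value i then increasing K (value i) (drop (suc (toℕ i′)) (word π)) else 0) else 0)
          ≡⟨ sum-uncons (λ b w → if b <ᵇ value i then increasing K (value i) w else 0) π (suc (toℕ i)) ⟩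
        uncons (λ b w → if b <ᵇ value i then increasing K (value i) w else 0) (drop (suc (toℕ i)) (word π))
          ≡⟨ descentsAt-uncons K (value i) (drop (suc (toℕ i)) (word π)) ⟨
        descentsAt K (value i) (drop (suc (toℕ i)) (word π))
          ∎

  -- Occurrences of 1-3-2, and avoidance in one-line notation

  Contains132 : Vec (Fin n) 3 → Set
  Contains132 (i ∷ j ∷ k ∷ []) = (i Fin.< j × j Fin.< k) × (value i < value k × value k < value j)

  132-occurrence⇒ : ∀ {is} → Occurrence ⟨1-3-2⟩ π is → Contains132 is
  132-occurrence⇒ {i ∷ j ∷ k ∷ []} (increases , iso , _) =
    (increases zero (suc zero) (s≤s z≤n) , increases (suc zero) (suc (suc zero)) (s≤s (s≤s z≤n))) ,
    (Equivalence.to (iso zero (suc (suc zero))) (s≤s z≤n) , Equivalence.to (iso (suc (suc zero)) (suc zero)) (s≤s (s≤s z≤n)))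

  132-occurrence⇐ : ∀ {is} → Contains132 is → Occurrence ⟨1-3-2⟩ π is
  132-occurrence⇐ {i ∷ j ∷ k ∷ []} ((i<j , j<k) , (vi<vk , vk<vj)) =
    increases , monotone⇒orderIsomorphic ⟨1-3-2⟩ (i ∷ j ∷ k ∷ []) mono , λ _ _ _ ()
    where
    increases : Increasing ⟨1-3-2⟩ π (i ∷ j ∷ k ∷ [])
    increases zero             (suc zero)       _ = i<j
    increases zero             (suc (suc zero)) _ = ℕ.<-trans i<j j<k
    increases (suc zero)       (suc (suc zero)) _ = j<k
    increases (suc zero)       (suc zero)       (s≤s ())
    increases (suc (suc zero)) (suc zero)       (s≤s ())
    increases (suc (suc zero)) (suc (suc zero)) (s≤s (s≤s ()))

    mono : ∀ a b → letters ⟨1-3-2⟩ ⟨$⟩ʳ a Fin.< letters ⟨1-3-2⟩ ⟨$⟩ʳ b →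
           value (lookup (i ∷ j ∷ k ∷ []) a) < value (lookup (i ∷ j ∷ k ∷ []) b)
    mono zero             (suc zero)       _ = ℕ.<-trans vi<vk vk<vj
    mono zero             (suc (suc zero)) _ = vi<vk
    mono (suc (suc zero)) (suc zero)       _ = vk<vj
    mono (suc zero)       (suc zero)       (s≤s (s≤s ()))
    mono (suc zero)       (suc (suc zero)) (s≤s ())
    mono (suc (suc zero)) (suc (suc zero)) (s≤s ())

∈-words : ∀ {m n} (v : Vec (Fin n) m) → v ∈ words m n
∈-words []      = here refl
∈-words (i ∷ v) = ∈-cartesianProductWith⁺ _∷_ (∈-allFin i) (∈-words v)

All-word⁺ : ∀ {P : ℕ → Set} {m n} (π : Vec (Fin n) m) → (∀ i → P (toℕ (lookup π i))) → All P (word π)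
All-word⁺ []      p = []
All-word⁺ (a ∷ π) p = p zero ∷ All-word⁺ π (p ∘ suc)

All-word⁻ : ∀ {P : ℕ → Set} {m n} (π : Vec (Fin n) m) → All P (word π) → ∀ i → P (toℕ (lookup π i))
All-word⁻ (a ∷ π) (p ∷ _)  zero    = p
All-word⁻ (a ∷ π) (_ ∷ ps) (suc i) = All-word⁻ π ps i

AllPairs-word⁺ : ∀ {P : ℕ → ℕ → Set} {m n} (π : Vec (Fin n) m) →
                 (∀ i j → i Fin.< j → P (toℕ (lookup π i)) (toℕ (lookup π j))) → AllPairs P (word π)
AllPairs-word⁺ []      p = []
AllPairs-word⁺ (a ∷ π) p = All-word⁺ π (λ j → p zero (suc j) (s≤s z≤n)) ∷
                           AllPairs-word⁺ π (λ i j i<j → p (suc i) (suc j) (s≤s i<j))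

AllPairs-word⁻ : ∀ {P : ℕ → ℕ → Set} {m n} (π : Vec (Fin n) m) → AllPairs P (word π) →
                 ∀ i j → i Fin.< j → P (toℕ (lookup π i)) (toℕ (lookup π j))
AllPairs-word⁻ (a ∷ π) (p ∷ _)  zero    (suc j) _         = All-word⁻ π p j
AllPairs-word⁻ (a ∷ π) (_ ∷ ps) (suc i) (suc j) (s≤s i<j) = AllPairs-word⁻ π ps i j i<j

Avoids-word⁺ : ∀ {m n} (π : Vec (Fin n) m) →
  (∀ i j k → i Fin.< j → j Fin.< k → ¬ (lookup π i Fin.< lookup π k × lookup π k Fin.< lookup π j)) → Avoids (word π)
Avoids-word⁺ []      p = tt
Avoids-word⁺ (a ∷ π) p =
  AllPairs-word⁺ π (λ j k j<k → p zero (suc j) (suc k) (s≤s z≤n) (s≤s j<k)) ,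
  Avoids-word⁺ π (λ i j k i<j j<k → p (suc i) (suc j) (suc k) (s≤s i<j) (s≤s j<k))

Avoids-word⁻ : ∀ {m n} (π : Vec (Fin n) m) → Avoids (word π) →
  ∀ i j k → i Fin.< j → j Fin.< k → ¬ (lookup π i Fin.< lookup π k × lookup π k Fin.< lookup π j)
Avoids-word⁻ (a ∷ π) (p , _)  zero    (suc j) (suc k) _         (s≤s j<k) = AllPairs-word⁻ π p j k j<k
Avoids-word⁻ (a ∷ π) (_ , av) (suc i) (suc j) (suc k) (s≤s i<j) (s≤s j<k) = Avoids-word⁻ π av i j k i<j j<k

no-occurrences⇒Avoids : ∀ {n} (π : Vec (Fin n) n) → occurrences ⟨1-3-2⟩ π ≡ 0 → Avoids (word π)
no-occurrences⇒Avoids π none = Avoids-word⁺ π λ i j k i<j j<k p →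
  none⇒¬ (i ∷ j ∷ k ∷ []) (132-occurrence⇐ π {i ∷ j ∷ k ∷ []} ((i<j , j<k) , p))
  where
  none⇒¬ : ∀ is → ¬ Occurrence ⟨1-3-2⟩ π is
  none⇒¬ is occ = ℕ.<⇒≢ (∈-length (∈-filter⁺ (occurrence? ⟨1-3-2⟩ π) (∈-words is) occ)) (sym none)

Avoids⇒no-occurrences : ∀ {n} (π : Vec (Fin n) n) → Avoids (word π) → occurrences ⟨1-3-2⟩ π ≡ 0
Avoids⇒no-occurrences π av = cong length (List.filter-none (occurrence? ⟨1-3-2⟩ π) (All.universal ¬occ (words 3 _)))
  where
  ¬occ : ∀ is → ¬ Occurrence ⟨1-3-2⟩ π is
  ¬occ (i ∷ j ∷ k ∷ []) occ with (i<j , j<k) , p ← 132-occurrence⇒ π {i ∷ j ∷ k ∷ []} occ =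
    Avoids-word⁻ π av i j k i<j j<k p

-- The decomposition of avoiders

avoiderWords : ℕ → List (List ℕ)
avoiderWords n = map word (avoiders n)

word-injective : ∀ {m n} {π ρ : Vec (Fin n) m} → word π ≡ word ρ → π ≡ ρ
word-injective {π = []}    {[]}    _  = refl
word-injective {π = i ∷ π} {j ∷ ρ} eq =
  cong₂ _∷_ (Fin.toℕ-injective (List.∷-injectiveˡ eq)) (word-injective (List.∷-injectiveʳ eq))

length-word : ∀ {m n} (π : Vec (Fin n) m) → length (word π) ≡ m
length-word π = trans (List.length-map toℕ (Vec.toList π)) (Vec.length-toList π)

Unique-word⁺ : ∀ {m n} (π : Vec (Fin n) m) → VecUnique π → Unique (word π)
Unique-word⁺ π π! = AllPairs-word⁺ π λ i j i<j πᵢ≡πⱼ →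
  ℕ.<⇒≢ i<j (cong toℕ (VecUnique.lookup-injective π! i j (Fin.toℕ-injective πᵢ≡πⱼ)))

Unique-word⁻ : ∀ {m n} (π : Vec (Fin n) m) → Unique (word π) → VecUnique π
Unique-word⁻ []      []         = VecAllPairs.[]
Unique-word⁻ (a ∷ π) (a∉π ∷ π!) = all π a∉π VecAllPairs.∷ Unique-word⁻ π π!
  where
  all : ∀ {m} (π : Vec _ m) → All (toℕ a ≢_) (word π) → VecAll.All (a ≢_) π
  all []      []       = VecAll.[]
  all (b ∷ π) (p ∷ ps) = (p ∘ cong toℕ) VecAll.∷ all π ps

word-surjective : ∀ {n w} → All (_< n) w → ∃ λ (π : Vec (Fin n) (length w)) → word π ≡ w
word-surjective []        = [] , refl
word-surjective (a<n ∷ p) with π , πw ← word-surjective p = fromℕ< a<n ∷ π , cong₂ _∷_ (Fin.toℕ-fromℕ< a<n) πw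

∈-permutations⁻ : ∀ {n} {π : Vec (Fin n) n} → π ∈ permutations n → VecUnique π
∈-permutations⁻ {n} π∈ = proj₂ (∈-filter⁻ _ {xs = words n n} π∈)

∈-permutations⁺ : ∀ {n} {π : Vec (Fin n) n} → VecUnique π → π ∈ permutations n
∈-permutations⁺ {n} {π} π! = ∈-filter⁺ _ (∈-words π) π!

∈-avoiders⁻ : ∀ {n} {π : Vec (Fin n) n} → π ∈ avoiders n → π ∈ permutations n × occurrences ⟨1-3-2⟩ π ≡ 0
∈-avoiders⁻ {n} = ∈-filter⁻ (λ π → occurrences ⟨1-3-2⟩ π ℕ.≟ 0) {xs = permutations n}

∈-avoiders⁺ : ∀ {n} {π : Vec (Fin n) n} → π ∈ permutations n → occurrences ⟨1-3-2⟩ π ≡ 0 → π ∈ avoiders n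
∈-avoiders⁺ {n} = ∈-filter⁺ (λ π → occurrences ⟨1-3-2⟩ π ℕ.≟ 0) {xs = permutations n}

avoider-word : ∀ {n} {π : Vec (Fin n) n} → π ∈ avoiders n → Avoider n (word π)
avoider-word {n} {π} π∈ = record
  { size    = length-word π
  ; bounded = All-word⁺ π (λ i → Fin.toℕ<n (lookup π i))
  ; unique  = Unique-word⁺ π (∈-permutations⁻ (proj₁ (∈-avoiders⁻ π∈)))
  ; avoids  = no-occurrences⇒Avoids π (proj₂ (∈-avoiders⁻ π∈))
  }

∈-avoiderWords⁻ : ∀ {n w} → w ∈ avoiderWords n → Avoider n w
∈-avoiderWords⁻ {n} {w} w∈ = from (∈-map⁻ word w∈)
  where
  from : (∃ λ π → π ∈ avoiders n × w ≡ word π) → Avoider n w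
  from (π , π∈ , w≡) = subst (Avoider n) (sym w≡) (avoider-word π∈)

∈-avoiderWords⁺ : ∀ {n w} → Avoider n w → w ∈ avoiderWords n
∈-avoiderWords⁺ {w = w} (avoider refl w< w! av) = from (word-surjective w<)
  where
  from : (∃ λ (π : Vec (Fin (length w)) (length w)) → word π ≡ w) → w ∈ avoiderWords (length w)
  from (π , πw) = subst (_∈ avoiderWords (length w)) πw (∈-map⁺ word (∈-avoiders⁺
    (∈-permutations⁺ (Unique-word⁻ π (subst Unique (sym πw) w!)))
    (Avoids⇒no-occurrences π (subst Avoids (sym πw) av))))

words-unique : ∀ m n → Unique (words m n)
words-unique zero    n = [] ∷ []
words-unique (suc m) n = Unique.cartesianProductWith⁺ _∷_ Vec.∷-injective (Unique.allFin⁺ n) (words-unique m n)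

avoiderWords-unique : ∀ n → Unique (avoiderWords n)
avoiderWords-unique n = Unique.map⁺ word-injective (Unique.filter⁺ _ (Unique.filter⁺ _ (words-unique n n)))

-- Neither prefix contains `m`, so its first appearance marks the cut in both words.
split-injective : ∀ {A : Set} {m : A} {xs xs′ ys ys′} → All (_≢ m) xs → All (_≢ m) xs′ →
                  xs ++ m ∷ ys ≡ xs′ ++ m ∷ ys′ → xs ≡ xs′ × ys ≡ ys′
split-injective []        []         eq = refl , List.∷-injectiveʳ eq
split-injective []        (≢m ∷ _)   eq = ⊥-elim (≢m (sym (List.∷-injectiveˡ eq)))
split-injective (≢m ∷ _)  []         eq = ⊥-elim (≢m (List.∷-injectiveˡ eq))
split-injective (_ ∷ ≢m) (_ ∷ ≢m′)   eq with refl , eq′ ← List.∷-injective eq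
  with refl , refl ← split-injective ≢m ≢m′ eq′ = refl , refl

-- Equal lengths give equal maxima, at which both words are cut; the right parts then agree, so both
-- left parts were raised by the same amount.
◇-injective : ∀ {L L′ R R′} → All (_< length L) L → All (_< length L′) L′ → L ◇ R ≡ L′ ◇ R′ → L ≡ L′ × R ≡ R′
◇-injective {L} {L′} {R} {R′} L< L′< eq = unshift
  (split-injective (≢max R L<) (subst (λ m → All (_≢ m) (map (length R′ +_) L′)) (sym m≡) (≢max R′ L′<))
    (trans eq (cong (λ m → map (length R′ +_) L′ ++ m ∷ R′) (sym m≡))))
  where
  m≡ : length L + length R ≡ length L′ + length R′
  m≡ = ℕ.suc-injective (trans (sym (length-◇ L R)) (trans (cong length eq) (length-◇ L′ R′)))

  ≢max : ∀ {L} R → All (_< length L) L → All (_≢ length L + length R) (map (length R +_) L)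
  ≢max {L} R L< = All.map⁺ (All.map
    (λ a< → ℕ.<⇒≢ (ℕ.<-≤-trans (ℕ.+-monoʳ-< (length R) a<) (ℕ.≤-reflexive (ℕ.+-comm (length R) (length L))))) L<)

  unshift : ∀ {L L′ R R′} → map (length R +_) L ≡ map (length R′ +_) L′ × R ≡ R′ → L ≡ L′ × R ≡ R′
  unshift {R = R} (L≡ , refl) = List.map-injective (ℕ.+-cancelˡ-≡ (length R) _ _) L≡ , refl

-- Injectivity is asked only for left factors from `xs`, because `◇-injective` needs their letters
-- bounded by their length.
cartesianProductWith-unique : ∀ {A B C : Set} (g : A → B → C) {xs ys} →
  (∀ {a a′ b b′} → a ∈ xs → a′ ∈ xs → g a b ≡ g a′ b′ → a ≡ a′ × b ≡ b′) →
  Unique xs → Unique ys → Unique (cartesianProductWith g xs ys)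
cartesianProductWith-unique g                   g-inj []          ys! = []
cartesianProductWith-unique g {x ∷ xs} {ys} g-inj (x∉xs ∷ xs!) ys! =
  Unique.++⁺ (Unique.map⁺ (proj₂ ∘ g-inj (here refl) (here refl)) ys!)
             (cartesianProductWith-unique g (λ a∈ a′∈ → g-inj (there a∈) (there a′∈)) xs! ys!)
             disjoint
  where
  disjoint : Disjoint (map (g x) ys) (cartesianProductWith g xs ys)
  disjoint (v∈ , v∈′) with b , _ , refl ← ∈-map⁻ (g x) v∈
    with a , b′ , a∈ , _ , eq ← ∈-cartesianProductWith⁻ g xs ys v∈′ =
    All.lookup x∉xs a∈ (proj₁ (g-inj (here refl) (there a∈) eq))

-- W stands for avoiderWords, which must not be unfolded here: its normal form is huge.
module _ (W : ℕ → List (List ℕ)) (W-unique : ∀ n → Unique (W n))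
         (∈W⇒Avoider : ∀ {n w} → w ∈ W n → Avoider n w)
         (Avoider⇒∈W : ∀ {n w} → Avoider n w → w ∈ W n) where

  W-bounded : ∀ {n w} → w ∈ W n → All (_< length w) w
  W-bounded w∈ with avoider refl w< _ _ ← ∈W⇒Avoider w∈ = w<

  W-avoider : ∀ {n w} → w ∈ W n → Avoider (length w) w
  W-avoider w∈ with w-av@(avoider refl _ _ _) ← ∈W⇒Avoider w∈ = w-av

  sizeOf : ∀ {n w} → w ∈ W n → length w ≡ n
  sizeOf w∈ = Avoider.size (∈W⇒Avoider w∈)

  ∈-products⁻ : ∀ n i {w} → w ∈ products _◇_ W n i →
                ∃₂ λ L R → L ∈ W (toℕ i) × R ∈ W (n ∸ toℕ i) × w ≡ L ◇ R
  ∈-products⁻ n i = ∈-cartesianProductWith⁻ _◇_ (W (toℕ i)) (W (n ∸ toℕ i))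

  -- Different indices give disjoint lists, since the product determines `L` and the index is the
  -- length of `L`.
  products-unique : ∀ n → Unique (concat (tabulate (products _◇_ W n)))
  products-unique n = Unique.concat⁺
    (All.tabulate⁺ λ i → cartesianProductWith-unique _◇_
      (λ L∈ L′∈ → ◇-injective (W-bounded L∈) (W-bounded L′∈))
      (W-unique (toℕ i)) (W-unique (n ∸ toℕ i)))
    (AllPairs.tabulate⁺ disjoint)
    where
    disjoint : ∀ {i j} → i ≢ j → Disjoint (products _◇_ W n i) (products _◇_ W n j)
    disjoint {i} {j} i≢j (w∈ , w∈′) with L , R , L∈ , _ , refl ← ∈-products⁻ n i w∈
      with L′ , R′ , L′∈ , _ , eq ← ∈-products⁻ n j w∈′ =
      i≢j (Fin.toℕ-injective (trans (sym (sizeOf L∈)) (trans (cong length L≡L′) (sizeOf L′∈))))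
      where
      L≡L′ : L ≡ L′
      L≡L′ = proj₁ (◇-injective (W-bounded L∈) (W-bounded L′∈) eq)

  -- Both lists are free of repetitions, so it is enough that they have the same members.
  W-suc : ∀ n → W (suc n) ↭ concat (tabulate (products _◇_ W n))
  W-suc n = ∼bag⇒↭ (unique∧set⇒bag (W-unique (suc n)) (products-unique n) (mk⇔ split glue))
    where
    split : ∀ {w} → w ∈ W (suc n) → w ∈ concat (tabulate (products _◇_ W n))
    split w∈ with L , R , L-av , R-av , refl , refl ← ◇-surjective (∈W⇒Avoider w∈) =
      ∈-concat⁺′ (∈-cartesianProductWith⁺ _◇_
          (Avoider⇒∈W (subst (λ l → Avoider l L) (sym i≡) L-av))
          (Avoider⇒∈W (subst (λ l → Avoider l R) (sym n∸i≡) R-av)))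
        (∈-tabulate⁺ {f = products _◇_ W n} i)
      where
      i : Fin (suc n)
      i = fromℕ< (s≤s (ℕ.m≤m+n (length L) (length R)))
      i≡ : toℕ i ≡ length L
      i≡ = Fin.toℕ-fromℕ< _
      n∸i≡ : n ∸ toℕ i ≡ length R
      n∸i≡ = trans (cong (n ∸_) i≡) (ℕ.m+n∸m≡n (length L) (length R))

    glue : ∀ {w} → w ∈ concat (tabulate (products _◇_ W n)) → w ∈ W (suc n)
    glue w∈ with _ , w∈′ , p∈ ← ∈-concat⁻′ (tabulate (products _◇_ W n)) w∈
      with i , refl ← ∈-tabulate⁻ {f = products _◇_ W n} p∈ with L , R , L∈ , R∈ , refl ← ∈-products⁻ n i w∈′ =
      Avoider⇒∈W (subst (λ l → Avoider (suc l) (L ◇ R)) |L|+|R|≡n (◇-avoider (W-avoider L∈) (W-avoider R∈)))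
      where
      |L|+|R|≡n : length L + length R ≡ n
      |L|+|R|≡n = trans (cong₂ _+_ (sizeOf L∈) (sizeOf R∈)) (ℕ.m+[n∸m]≡n (ℕ.≤-pred (Fin.toℕ<n i)))

-- The generating functions

open Enumerator ℤ[y] ℤ[y]-isCommutativeRing y

coeff-y^ : ∀ d r → coeff (y ^ d) r ≡ (if d ≡ᵇ r then ℤ.1ℤ else ℤ.0ℤ)
coeff-y^ zero    zero    = refl
coeff-y^ zero    (suc r) = refl
coeff-y^ (suc d) zero    = ℤ-series.var*-zero (coeff (y ^ d))
coeff-y^ (suc d) (suc r) = trans (ℤ-series.var*-suc (coeff (y ^ d)) r) (coeff-y^ d r)

coeff-enumerate : ∀ {A : Set} (s : A → ℕ) xs r → coeff (enumerate s xs) r ≡ ℤ.+ count (λ a → s a ℕ.≟ r) xs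
coeff-enumerate s []       r = refl
coeff-enumerate s (a ∷ xs) r = trans (cong₂ ℤ._+_ (coeff-y^ (s a) r) (coeff-enumerate s xs r)) add
  where
  add : (if s a ≡ᵇ r then ℤ.1ℤ else ℤ.0ℤ) ℤ.+ (ℤ.+ count (λ a → s a ℕ.≟ r) xs) ≡ ℤ.+ count (λ a → s a ℕ.≟ r) (a ∷ xs)
  add with s a ≡ᵇ r
  ... | true  = refl
  ... | false = refl

coeff-enumerate-map : ∀ {A B : Set} (s : B → ℕ) (g : A → B) {t : A → ℕ} → (∀ a → t a ≡ s (g a)) → ∀ xs r →
                      coeff (enumerate s (map g xs)) r ≡ ℤ.+ count (λ a → t a ℕ.≟ r) xs
coeff-enumerate-map s g {t} t≡ xs r = begin
  coeff (enumerate s (map g xs)) r           ≡⟨ coeff-enumerate s (map g xs) r ⟩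
  ℤ.+ count (λ b → s b ℕ.≟ r) (map g xs)     ≡⟨ cong ℤ.+_ (count-map (λ b → s b ℕ.≟ r) g xs) ⟩
  ℤ.+ count (λ a → s (g a) ℕ.≟ r) xs         ≡⟨ cong ℤ.+_ (count-≐ (λ a → s (g a) ℕ.≟ r) (λ a → t a ℕ.≟ r)
                                                  ((λ {a} → trans (t≡ a)) , (λ {a} → trans (sym (t≡ a)))) xs) ⟩
  ℤ.+ count (λ a → t a ℕ.≟ r) xs             ∎
  where open ≡-Reasoning

statistic-[] : ∀ e K → statistic e K [] ≡ 0
statistic-[] zero    K       = refl
statistic-[] (suc e) zero    = statistic-[] e zero
statistic-[] (suc e) (suc K) = cong₂ _+_ (statistic-[] e K) (statistic-[] e (suc K))

ifNonempty-Avoider : ∀ {n w} d → Avoider (suc n) w → ifNonempty d w ≡ d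
ifNonempty-Avoider {w = _ ∷ _} d _ = refl

module _ (K : ℕ) where

  G : ℕ → Series
  G e n = enumerate (statistic e K) (avoiderWords n)

  G-IsStep : ∀ e → SR.IsStep (y ^ (e C K)) (G (suc e)) (G e)
  G-IsStep e = enumerate-IsStep avoiderWords _◇_
    {statistic e K} {statistic (suc e) K} {λ R → ifNonempty (e C K) R + statistic e K R}
    refl
    (W-suc avoiderWords avoiderWords-unique ∈-avoiderWords⁻ ∈-avoiderWords⁺)
    (statistic-[] e K)
    (λ L∈ R∈ → statistic-◇ e K (L<|L| L∈) (L<|L| R∈))
    (statistic-[] e K)
    (λ {n} {R} R∈ → cong (_+ statistic e K R) (ifNonempty-Avoider (e C K) (∈-avoiderWords⁻ R∈)))
    where L<|L| = W-bounded avoiderWords avoiderWords-unique ∈-avoiderWords⁻ ∈-avoiderWords⁺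

  -- `statistic 0 K` is `descents K`, which counts the occurrences of the pattern in `word π`.
  G≈F : ∀ n r → coeff (G 0 n) r ≡ coeff (F (⟨21-3-⋯-k⟩ {suc (suc K)} (s≤s (s≤s z≤n))) n) r
  G≈F n r = coeff-enumerate-map (descents K) word {occurrences (⟨21-3-⋯-k⟩ {suc (suc K)} (s≤s (s≤s z≤n)))}
    (λ π → occurrences-descents π) (avoiders n) r

theorem2p9 : (k : ℕ) (2≤k : 2 ≤ k) → convergent (λ i → (i ∸ 1) C (k ∸ 2)) ConvergesTo F (⟨21-3-⋯-k⟩ 2≤k)
theorem2p9 (suc (suc K)) (s≤s (s≤s z≤n)) N = proj₁ G-limit , λ m M≤m n n<N r →
  trans (proj₂ G-limit m M≤m n n<N r) (G≈F K n r)
  -- With `K = k ∸ 2`, the exponent at place `suc e` computes to `e C K`, the one in `G-IsStep`.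
  where G-limit = convergent-converges (λ i → (i ∸ 1) C K) (G K) (G-IsStep K) N
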